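{- Let $n,m$ be positive integers with $m+2\leq n$, let $G=P^m_n$ (the $m$-th power of the path $P_n$, with vertex set $[n]$), and let $\mathcal R=\{G_i:i\in [n]\}$ be a family of graphs. Let $\tilde{\mathcal I}$ denote the family of non-empty independent sets $I$ of $P_n^m$ with $m(I)\leq m+1$ and $M(I)\geq n-m$, where $m(I)=\min\{i: i\in I\}$ and $M(I)=\max\{i: i\in I\}$. Then $$\gamma_{gr}(G\hookleftarrow \mathcal R)=\max_{I \in \tilde{\mathcal I}} \left\{\sum_{i\in I} (\gamma_{gr} (G_i)-1)+ M(I)-m(I)-|I|m\right\}+m+1.$$ Moreover, given a Grundy dominating sequence $S_i$ of $G_i$ for all $i\in [n]$, and given $I^*\in \tilde{\mathcal I}$ such that $$\sum_{i\in I^*} (\gamma_{gr} (G_i)-1)+M(I^*)-m(I^*)- |I^*|m+m+1=\gamma_{gr}(G\hookleftarrow \mathcal R),$$ the sequence $S$ obtained by replacing in $S_P(I^*)$ each $i\in I^*$ by $S_i$ is a Grundy dominating sequence of $G\hookleftarrow \mathcal R$.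
   Context: $G\hookleftarrow \mathcal R$ denotes the $X$-join product: the graph obtained from $G$ by replacing each vertex $v$ by the graph $G_v\in\mathcal R$ (vertices of $G_u$ and $G_v$ are all adjacent iff $uv\in E(G)$). For a sequence $S=(v_1,\dots,v_k)$ of distinct vertices, $PN_S(v_i)=N[v_i]\setminus\bigcup_{j<i}N[v_j]$; $S$ is a legal dominating sequence if its vertex set dominates the graph and every $PN_S(v_i)\neq\emptyset$. A Grundy dominating sequence is a legal dominating sequence of maximum length, and $\gamma_{gr}$ (Grundy domination number) is that length. For $1\leq i\leq j\leq n$, $S(i,j)=(i,i+1,\dots,j)$; $\oplus$ is concatenation of sequences. For $I=\{i^1<\dots<i^p\}\in\tilde{\mathcal I}$, $S_j=S(i^j,i^{j+1}-(m+1))$ for $j\in[p-1]$ and $S_P(I)=\left(\bigoplus_{j=1}^{p-1}S_j\right)\oplus(i^p)$; it is a legal dominating sequence of $P_n^m$ of length $M(I)-m(I)+1-(|I|-1)m$. -}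

module Defs where

open import Data.Nat.Base using (ℕ; zero; suc; _+_; _*_; _∸_; _≤_; _<_; _<ᵇ_; _≤ᵇ_; ∣_-_∣; _⊓_; _⊔_)
open import Data.Nat.Properties using (_<?_)
open import Data.Bool.Base using (Bool; true; false; _∧_; if_then_else_)
open import Data.Fin.Base using (Fin; toℕ; fromℕ<)
open import Data.Fin.Properties using (_≟_)
open import Data.Fin.Subset using (Subset; _∈_; ∣_∣; Nonempty)
open import Data.List.Base using (List; []; _∷_; [_]; _++_; map; upTo; allFin; filterᵇ; foldr; length; lookup; concatMap)
open import Data.List.Membership.Propositional using () renaming (_∈_ to _∈ₗ_)
open import Data.List.Relation.Unary.Unique.Propositional using (Unique)
open import Data.Vec.Base using () renaming (lookup to vlookup)
open import Data.Product using (Σ; _×_; _,_; ∃)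
open import Data.Sum using (_⊎_)
open import Data.Integer.Base using (ℤ; +_) renaming (_+_ to _+ℤ_; _-_ to _-ℤ_)
open import Relation.Binary.PropositionalEquality using (_≡_; refl)
open import Relation.Nullary using (¬_; yes; no)

record Graph : Set₁ where
  field
    V   : Set
    adj : V → V → Bool

open Graph public

record FinGraph : Set where
  field
    size     : ℕ
    nonempty : 1 ≤ size
    fadj     : Fin size → Fin size → Bool
    fsym     : ∀ u v → fadj u v ≡ fadj v u
    firrefl  : ∀ v → fadj v v ≡ false

open FinGraph public

toGraph : FinGraph → Graph
toGraph H = record { V = Fin (size H) ; adj = fadj H }

InN : (G : Graph) → V G → V G → Set
InN G v u = (u ≡ v) ⊎ (adj G v u ≡ true)

PNNonempty : (G : Graph) (S : List (V G)) → Fin (length S) → Set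
PNNonempty G S i =
  ∃ λ u → InN G (lookup S i) u × (∀ j → toℕ j < toℕ i → ¬ InN G (lookup S j) u)

Dominating : (G : Graph) → List (V G) → Set
Dominating G S = ∀ u → ∃ λ v → (v ∈ₗ S) × InN G v u

LegalDom : (G : Graph) → List (V G) → Set
LegalDom G S = Unique S × Dominating G S × (∀ i → PNNonempty G S i)

IsGrundyDomSeq : (G : Graph) → List (V G) → Set
IsGrundyDomSeq G S = LegalDom G S × (∀ S′ → LegalDom G S′ → length S′ ≤ length S)

IsGrundyNumber : (G : Graph) → ℕ → Set
IsGrundyNumber G k =
  (∃ λ S → LegalDom G S × length S ≡ k) × (∀ S′ → LegalDom G S′ → length S′ ≤ k)

-- The path power P_n^m on vertex set Fin n (vertex v has label toℕ v + 1)

pathPowAdj : (n m : ℕ) → Fin n → Fin n → Bool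
pathPowAdj n m i j = (0 <ᵇ d) ∧ (d ≤ᵇ m)
  where d = ∣ toℕ i - toℕ j ∣

PathPow : (n m : ℕ) → Graph
PathPow n m = record { V = Fin n ; adj = pathPowAdj n m }

JV : (n : ℕ) → (Fin n → FinGraph) → Set
JV n R = Σ (Fin n) (λ i → Fin (size (R i)))

joinAdj : (n m : ℕ) (R : Fin n → FinGraph) → JV n R → JV n R → Bool
joinAdj n m R (i , x) (j , y) with i ≟ j
... | yes refl = fadj (R i) x y
... | no _ = pathPowAdj n m i j

Join : (n m : ℕ) → (Fin n → FinGraph) → Graph
Join n m R = record { V = JV n R ; adj = joinAdj n m R }

elems : {n : ℕ} → Subset n → List (Fin n)
elems {n} I = filterᵇ (λ x → vlookup I x) (allFin n)

labels : {n : ℕ} → Subset n → List ℕ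
labels I = map (λ x → suc (toℕ x)) (elems I)

minL : List ℕ → ℕ
minL []       = 0
minL (x ∷ xs) = foldr _⊓_ x xs

maxL : List ℕ → ℕ
maxL = foldr _⊔_ 0

mI : {n : ℕ} → Subset n → ℕ
mI I = minL (labels I)

MI : {n : ℕ} → Subset n → ℕ
MI I = maxL (labels I)

Independent : (G : Graph) → (V G → Set) → Set
Independent G P = ∀ x y → P x → P y → adj G x y ≡ false

InItilde : (n m : ℕ) → Subset n → Set
InItilde n m I =
  Nonempty I × Independent (PathPow n m) (λ x → x ∈ I) ×
  (mI I ≤ m + 1) × (n ∸ m ≤ MI I)

objective : (n m : ℕ) → (Fin n → ℕ) → Subset n → ℤ
objective n m g I =
  foldr _+ℤ_ (+ 0) (map (λ i → (+ g i) -ℤ (+ 1)) (elems I))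
  +ℤ (+ MI I) -ℤ (+ mI I) -ℤ (+ (∣ I ∣ * m))

S-range : ℕ → ℕ → List ℕ
S-range i j = map (λ t → i + t) (upTo (suc j ∸ i))

SPList : ℕ → List ℕ → List ℕ
SPList m []             = []
SPList m (x ∷ [])       = x ∷ []
SPList m (x ∷ ys@(y ∷ _)) = S-range x (y ∸ (m + 1)) ++ SPList m ys

SP : {n : ℕ} → ℕ → Subset n → List ℕ
SP m I = SPList m (labels I)

expand : (n : ℕ) (R : Fin n → FinGraph) → Subset n →
         ((i : Fin n) → List (Fin (size (R i)))) →
         ((i : Fin n) → Fin (size (R i))) → ℕ → List (JV n R)
expand n R I Ss c zero = []
expand n R I Ss c (suc k) with k <? n
... | no _  = []
... | yes p with vlookup I (fromℕ< p)
...   | true  = map (λ x → (fromℕ< p , x)) (Ss (fromℕ< p))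
...   | false = [ (fromℕ< p , c (fromℕ< p)) ]

replaceSeq : (n m : ℕ) (R : Fin n → FinGraph) → Subset n →
             ((i : Fin n) → List (Fin (size (R i)))) →
             ((i : Fin n) → Fin (size (R i))) → List (JV n R)
replaceSeq n m R I Ss c = concatMap (expand n R I Ss c) (SP m I)

-- Attach to each vertex v of a legal sequence of the join a footprint u, choosing u = v whenever v is
-- not yet dominated, and let p and w be the path indices of v and u. Call a path index an anchor if
-- p = w = a for some entry. Anchors are independent; at most γ_gr(G_a) entries have w = a when a is an
-- anchor and at most one otherwise. Between consecutive anchors a < b, with θ the earlier of their
-- times, mapping an entry to p before θ and to w after θ is injective, and by legality its image
-- misses m of the indices strictly between a and b. Adding 1 or n to the anchors when none is close
-- enough to that end gives a set I that bounds the length of the sequence. Conversely, in the sequence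
-- built from I, the Grundy sequence of G_i is footprinted inside G_i for i in I, and the single vertex
-- of any other G_i is footprinted in G_{i+m}.

module Submission where

open import Defs
open import Data.Bool.Base using (Bool; true; false; if_then_else_)
import Data.Bool.Properties as Bool
open import Data.Empty using (⊥)
open import Data.Fin.Base using (Fin; zero; suc; toℕ; fromℕ<)
import Data.Fin.Properties as Fin
open import Data.Fin.Subset using (Subset; _∈_; ∣_∣)
open import Data.Integer.Base using (ℤ; +_; -_; +≤+) renaming (_+_ to _+ℤ_; _-_ to _-ℤ_; _*_ to _*ℤ_; _≤_ to _≤ℤ_)
import Data.Integer.Properties as ℤ
import Data.Integer.Tactic.RingSolver as ℤ-Solver
open import Data.List.Base using (List; []; _∷_; [_]; _++_; map; concatMap; foldr; length; lookup; tabulate; allFin; upTo; applyUpTo; filter; filterᵇ)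
open import Data.List.Membership.Propositional using (find; lose) renaming (_∈_ to _∈ₗ_)
open import Data.List.Membership.Propositional.Properties using (∈-map⁺; ∈-map⁻; ∈-allFin; ∈-lookup; ∈-filter⁺; ∈-filter⁻; ∈-length; ∈-upTo⁺; ∈-++⁺ˡ; ∈-++⁺ʳ; ∈-concatMap⁺)
open import Data.List.Properties using (map-++; map-∘; map-tabulate; tabulate-lookup; length-map; length-++; length-tabulate; length-applyUpTo; filter-none; filter-all; concatMap-++; concatMap-map; concatMap-cong)
open import Data.List.Relation.Unary.All as All using (All; []; _∷_)
import Data.List.Relation.Unary.All.Properties as All
open import Data.List.Relation.Unary.AllPairs as AllPairs using (AllPairs; []; _∷_)
import Data.List.Relation.Unary.AllPairs.Properties as AllPairs
open import Data.List.Relation.Unary.Any using (Any; here; there; any?)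
import Data.List.Relation.Unary.Any.Properties as Any
open import Data.List.Relation.Unary.Unique.Propositional using (Unique)
open import Data.Nat.Base using (ℕ; zero; suc; _+_; _*_; _∸_; _⊓_; _⊔_; _≤_; _<_; ∣_-_∣; z≤n; s≤s; s≤s⁻¹)
open import Data.Nat.ListAction using (sum)
open import Data.Nat.Properties
open import Data.Nat.Tactic.RingSolver using (solve-∀)
open import Data.Product using (_×_; _,_; ∃; proj₁; proj₂)
open import Data.Sum using (_⊎_; inj₁; inj₂; swap)
open import Data.Unit.Base using (⊤; tt)
open import Data.Vec.Base as Vec using ([]; _∷_) renaming (lookup to vlookup)
import Data.Vec.Properties as Vec
open import Function.Base using (_∘_; id)
open import Function.Bundles using (Equivalence; _⇔_; mk⇔)
open import Relation.Binary.Definitions using (tri<; tri≈; tri>)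
open import Relation.Binary.PropositionalEquality hiding ([_])
open import Relation.Nullary using (¬_; Dec; yes; no; contradiction)
open import Relation.Nullary.Decidable using (_⊎-dec_; _×-dec_; _→-dec_; T?; dec-true; does)
open import Relation.Unary using (Decidable)

-- Witnessed sequences and Grundy numbers of finite graphs

-- Let an anchor `a` have time θ, and consider entries footprinted away from `a`. A vertex before θ
-- must not dominate the footprint of θ, so its `p` is more than m away from `a` while its `w` may
-- be closer; a footprint after θ must not be dominated by the vertex of θ, so its `w` is kept away
-- while its `p` may be closer. Neither map alone suffices, hence the switch at θ. Entries before
-- the earlier of two anchor times precede both anchors, so their `p` cannot leave the gap; a later
-- `w` lies in it by definition. Footprints have to be chosen with care: with an arbitrary one, a
-- vertex could share a copy with a later footprint while its own footprint is elsewhere, and two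
-- indices that should be far apart would coincide. Every legal sequence is bounded directly through
-- its own set I, without first being brought to a normal form. A gap a < b holds at most b - a - (m
-- + 1) entries; these subtractions are moved to the other side, so that the counting stays in the
-- natural numbers.

AllPairs-refine : {A : Set} {P : A → Set} {Q R : A → A → Set} →
  (∀ {x y} → P x → P y → Q x y → R x y) →
  ∀ {xs} → All P xs → AllPairs Q xs → AllPairs R xs
AllPairs-refine f [] [] = []
AllPairs-refine f (px ∷ pxs) (qx ∷ qxs) =
  All.zipWith (λ (py , q) → f px py q) (pxs , qx) ∷ AllPairs-refine f pxs qxs

-- A sequence is paired entrywise with a footprint: an element of its private neighbourhood.
Witnessed : (G : Graph) → List (V G × V G) → Set
Witnessed G L =
  All (λ e → InN G (proj₁ e) (proj₂ e)) L ×
  AllPairs (λ e e′ → ¬ InN G (proj₁ e) (proj₂ e′)) L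

witnessed-tabulate : (G : Graph) {k : ℕ} (v u : Fin k → V G) →
  (∀ t → InN G (v t) (u t)) → (∀ {s t} → toℕ s < toℕ t → ¬ InN G (v s) (u t)) →
  Witnessed G (tabulate (λ t → v t , u t))
witnessed-tabulate G v u near far = All.tabulate⁺ near , AllPairs.tabulate⁺-< far

legal⇒witnessed : (G : Graph) {S : List (V G)} → (∀ i → PNNonempty G S i) →
  ∃ λ L → map proj₁ L ≡ S × Witnessed G L
legal⇒witnessed G {S} pn =
  tabulate (λ i → lookup S i , proj₁ (pn i)) ,
  trans (map-tabulate (λ i → lookup S i , proj₁ (pn i)) proj₁) (tabulate-lookup S) ,
  witnessed-tabulate G (lookup S) (λ i → proj₁ (pn i)) (λ i → proj₁ (proj₂ (pn i)))
    (λ {s} {t} → proj₂ (proj₂ (pn t)) s)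

-- The membership in `map proj₂ L` is what the induction needs: the head excludes all footprints of
-- the tail, so the one returned must be known to be among them.
witnessed⇒footprint : (G : Graph) {L : List (V G × V G)} → Witnessed G L →
  (i : Fin (length (map proj₁ L))) →
  ∃ λ u → u ∈ₗ map proj₂ L × InN G (lookup (map proj₁ L) i) u ×
          (∀ j → toℕ j < toℕ i → ¬ InN G (lookup (map proj₁ L) j) u)
witnessed⇒footprint G {(v , u) ∷ L} (near ∷ _ , _) zero = u , here refl , near , λ _ ()
witnessed⇒footprint G {(v , _) ∷ L} (_ ∷ nears , far ∷ fars) (suc i)
  with witnessed⇒footprint G (nears , fars) i
... | u , u∈ , near , before = u , there u∈ , near , λ where
      zero    _         → All.lookup (All.map⁺ far) u∈
      (suc j) (s≤s j<i) → before j j<i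

-- If a vertex recurred, the footprint of its later occurrence would lie in the closed neighbourhood
-- of the earlier one.
witnessed⇒unique : (G : Graph) {L : List (V G × V G)} → Witnessed G L → Unique (map proj₁ L)
witnessed⇒unique G (near , far) =
  AllPairs.map⁺ (AllPairs-refine (λ { _ near′ far′ refl → far′ near′ }) near far)

witnessed⇒legalDom : (G : Graph) {L : List (V G × V G)} → Witnessed G L →
  Dominating G (map proj₁ L) → LegalDom G (map proj₁ L)
witnessed⇒legalDom G wit dom =
  witnessed⇒unique G wit , dom ,
  λ i → let u , _ , near , before = witnessed⇒footprint G wit i in u , near , before

DominatedBy : (G : Graph) → List (V G × V G) → V G → Set
DominatedBy G L u = Any (λ e → InN G (proj₁ e) u) L

InN-fin? : (H : FinGraph) (v u : Fin (size H)) → Dec (InN (toGraph H) v u)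
InN-fin? H v u = (u Fin.≟ v) ⊎-dec (fadj H v u Bool.≟ true)

witnessed-snoc : (G : Graph) {L : List (V G × V G)} {u : V G} → Witnessed G L →
  ¬ DominatedBy G L u → Witnessed G (L ++ [ (u , u) ])
witnessed-snoc G (near , far) undom =
  All.++⁺ near (inj₁ refl ∷ []) ,
  AllPairs.++⁺ far ([] ∷ []) (All.map (λ ¬near → ¬near ∷ []) (All.¬Any⇒All¬ _ undom))

-- Greedy completion: an undominated vertex can be appended as its own footprint, and what is
-- dominated stays dominated as the sequence grows.
extend-dominating : (H : FinGraph) (us : List (Fin (size H))) →
  {L : List (Fin (size H) × Fin (size H))} → Witnessed (toGraph H) L →
  ∃ λ L′ → Witnessed (toGraph H) L′ × length L ≤ length L′ × All (DominatedBy (toGraph H) L′) us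
extend-dominating H [] {L} wit = L , wit , ≤-refl , []
extend-dominating H (u ∷ us) wit with extend-dominating H us wit
... | L′ , wit′ , len , dom with any? (λ e → InN-fin? H (proj₁ e) u) L′
...   | yes u-dom = L′ , wit′ , len , u-dom ∷ dom
...   | no undom  =
        L′ ++ [ (u , u) ] , witnessed-snoc (toGraph H) wit′ undom ,
        ≤-trans len (≤-trans (m≤m+n _ 1) (≤-reflexive (sym (length-++ L′)))) ,
        Any.++⁺ʳ L′ (here (inj₁ refl)) ∷ All.map Any.++⁺ˡ dom

-- `IsGrundyNumber` bounds dominating sequences only, whereas the part of a join sequence that is
-- footprinted in one copy need not dominate that copy. Completing it greedily closes this
-- difference.
witnessed-length≤ : (H : FinGraph) {k : ℕ} → IsGrundyNumber (toGraph H) k →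
  {L : List (Fin (size H) × Fin (size H))} → Witnessed (toGraph H) L → length L ≤ k
witnessed-length≤ H (_ , maximal) wit with extend-dominating H (allFin (size H)) wit
... | L′ , wit′ , len , dom =
  ≤-trans len (≤-trans (≤-reflexive (sym (length-map proj₁ L′)))
    (maximal (map proj₁ L′) (witnessed⇒legalDom (toGraph H) wit′ λ u →
      let (v , _) , e∈ , near = find (All.lookup dom (∈-allFin u))
      in v , ∈-map⁺ proj₁ e∈ , near)))

-- Counting footprints between anchors

AllPairs-lookup : {A : Set} {R : A → A → Set} {xs : List A} → AllPairs R xs →
  ∀ {i j} → toℕ i < toℕ j → R (lookup xs i) (lookup xs j)
AllPairs-lookup (r ∷ _)  {zero}  {suc j} _         = All.lookup r (∈-lookup j)
AllPairs-lookup (_ ∷ rs) {suc i} {suc j} (s≤s i<j) = AllPairs-lookup rs i<j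

unique-length≤ : ∀ {lo hi} {xs : List ℕ} → Unique xs → All (λ x → lo ≤ x × x < hi) xs →
  length xs ≤ hi ∸ lo
unique-length≤ {lo} {hi} {xs} uniq inside = Fin.injective⇒≤ {f = position} injective
  where
  bounds : ∀ i → lo ≤ lookup xs i × lookup xs i < hi
  bounds i = All.lookup inside (∈-lookup i)

  shifted<range : ∀ i → lookup xs i ∸ lo < hi ∸ lo
  shifted<range i = ∸-monoˡ-< (proj₂ (bounds i)) (proj₁ (bounds i))

  position : Fin (length xs) → Fin (hi ∸ lo)
  position i = fromℕ< (shifted<range i)

  lookup-eq : ∀ {i j} → position i ≡ position j → lookup xs i ≡ lookup xs j
  lookup-eq {i} {j} eq = ∸-cancelʳ-≡ (proj₁ (bounds i)) (proj₁ (bounds j))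
    (Fin.fromℕ<-injective _ _ (shifted<range i) (shifted<range j) eq)

  injective : ∀ {i j} → position i ≡ position j → i ≡ j
  injective {i} {j} eq with Fin.<-cmp i j
  ... | tri< i<j _ _ = contradiction (lookup-eq eq) (AllPairs-lookup uniq i<j)
  ... | tri≈ _ i≡j _ = i≡j
  ... | tri> _ _ j<i = contradiction (sym (lookup-eq eq)) (AllPairs-lookup uniq j<i)

length-filter-⊎ : {A : Set} {P Q R : A → Set}
  (P? : Decidable P) (Q? : Decidable Q) (R? : Decidable R) →
  (∀ x → P x → Q x ⊎ R x) → ∀ xs →
  length (filter P? xs) ≤ length (filter Q? xs) + length (filter R? xs)
length-filter-⊎ P? Q? R? split [] = z≤n
length-filter-⊎ P? Q? R? split (x ∷ xs) with length-filter-⊎ P? Q? R? split xs | P? x | Q? x | R? x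
... | ih | no _  | no _  | no _  = ih
... | ih | no _  | no _  | yes _ = ≤-trans ih (+-monoʳ-≤ _ (n≤1+n _))
... | ih | no _  | yes _ | no _  = m≤n⇒m≤1+n ih
... | ih | no _  | yes _ | yes _ = m≤n⇒m≤1+n (≤-trans ih (+-monoʳ-≤ _ (n≤1+n _)))
... | ih | yes p | yes _ | no _  = s≤s ih
... | ih | yes p | yes _ | yes _ = s≤s (≤-trans ih (+-monoʳ-≤ _ (n≤1+n _)))
... | ih | yes p | no _  | yes _ = ≤-trans (s≤s ih) (≤-reflexive (sym (+-suc _ _)))
... | ih | yes p | no ¬q | no ¬r with split x p
...   | inj₁ q = contradiction q ¬q
...   | inj₂ r = contradiction r ¬r

count : ∀ {k} {P : Fin k → Set} → Decidable P → ℕ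
count {k} P? = length (filter P? (allFin k))

count-⊎ : ∀ {k} {P Q R : Fin k → Set} (P? : Decidable P) (Q? : Decidable Q) (R? : Decidable R) →
  (∀ t → P t → Q t ⊎ R t) → count P? ≤ count Q? + count R?
count-⊎ P? Q? R? split = length-filter-⊎ P? Q? R? split (allFin _)

count-∅ : ∀ {k} {P : Fin k → Set} (P? : Decidable P) → (∀ t → ¬ P t) → count P? ≡ 0
count-∅ P? empty = cong length (filter-none P? (All.tabulate⁺ empty))

AllPairs-filter-allFin : ∀ {k} {P : Fin k → Set} (P? : Decidable P) {R : Fin k → Fin k → Set} →
  (∀ {s t} → P s → P t → toℕ s < toℕ t → R s t) → AllPairs R (filter P? (allFin k))
AllPairs-filter-allFin {k} P? f =
  AllPairs-refine f (All.all-filter P? (allFin k))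
    (AllPairs.filter⁺ P? (AllPairs.tabulate⁺-< {f = λ t → t} (λ s<t → s<t)))

lab : ∀ {n} → Fin n → ℕ
lab i = suc (toℕ i)

lab-injective : ∀ {n} {i j : Fin n} → lab i ≡ lab j → i ≡ j
lab-injective eq = Fin.toℕ-injective (suc-injective eq)

-- The path indices p t of the vertices of a legal sequence of the join and w t of their footprints.
record Timeline (n m T : ℕ) : Set where
  field
    p w  : Fin T → Fin n
    p≤w  : ∀ t → lab (p t) ≤ lab (w t) + m
    w≤p  : ∀ t → lab (w t) ≤ lab (p t) + m
    far  : ∀ {s t} → toℕ s < toℕ t → w s ≢ w t → lab (p s) + m < lab (w t) ⊎ lab (w t) + m < lab (p s)
    same : ∀ {s t} → toℕ s < toℕ t → w s ≡ w t → p s ≡ w s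

module Gaps {n m T : ℕ} (tl : Timeline n m T) where
  open Timeline tl

  Anchor : Fin n → Set
  Anchor a = ∃ λ t → p t ≡ a × w t ≡ a

  anchor? : Decidable Anchor
  anchor? a = Fin.any? (λ t → (p t Fin.≟ a) ×-dec (w t Fin.≟ a))

  -- The earlier anchor's vertex must not dominate the later anchor's footprint, and both sit at the
  -- anchors' own indices.
  anchors-far : ∀ {a b} → Anchor a → Anchor b → a ≢ b → lab a + m < lab b ⊎ lab b + m < lab a
  anchors-far (s , refl , ws) (t , refl , wt) a≢b with Fin.<-cmp s t
  ... | tri≈ _ refl _ = contradiction refl a≢b
  ... | tri< s<t _ _ = subst (λ b → lab (p s) + m < lab b ⊎ lab b + m < lab (p s)) wt
          (far s<t (λ eq → a≢b (trans (sym ws) (trans eq wt))))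
  ... | tri> _ _ t<s = swap (subst (λ a → lab (p t) + m < lab a ⊎ lab a + m < lab (p t)) ws
          (far t<s (λ eq → a≢b (trans (sym ws) (trans (sym eq) wt)))))

  anchors-gap : ∀ {a b} → Anchor a → Anchor b → lab a < lab b → lab a + m < lab b
  anchors-gap an bn a<b with anchors-far an bn (λ { refl → <-irrefl refl a<b })
  ... | inj₁ lt = lt
  ... | inj₂ lt = contradiction (<-trans a<b (≤-<-trans (m≤m+n _ m) lt)) (<-irrefl refl)

  -- Sending t to p t before time θ and to w t after it is injective on the entries whose footprint
  -- index is not an anchor; the offset o avoids truncated subtraction in the target interval.
  count≤interval : (θ : Fin T) (o lo hi : ℕ) {Q : Fin T → Set} (Q? : Decidable Q) →
    (∀ t → Q t → ¬ Anchor (w t)) → ¬ Q θ →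
    (∀ t → Q t → toℕ t < toℕ θ → lo ≤ o + lab (p t) × o + lab (p t) < hi) →
    (∀ t → Q t → toℕ θ < toℕ t → lo ≤ o + lab (w t) × o + lab (w t) < hi) →
    count Q? ≤ hi ∸ lo
  count≤interval θ o lo hi {Q} Q? free ¬Qθ early late =
    subst (_≤ hi ∸ lo) (length-map f (filter Q? (allFin T)))
      (unique-length≤ (AllPairs.map⁺ (AllPairs-filter-allFin Q? distinct))
        (All.map⁺ (All.map (λ {t} → inside t) (All.all-filter Q? (allFin T)))))
    where
    pick : Fin T → Fin n
    pick t with toℕ t <? toℕ θ
    ... | yes _ = p t
    ... | no  _ = w t

    f : Fin T → ℕ
    f t = o + lab (pick t)

    inside : ∀ t → Q t → lo ≤ f t × f t < hi
    inside t q with toℕ t <? toℕ θ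
    ... | yes t<θ = early t q t<θ
    ... | no  t≮θ with m≤n⇒m<n∨m≡n (≮⇒≥ t≮θ)
    ...   | inj₁ θ<t = late t q θ<t
    ...   | inj₂ θ≡t = contradiction (subst Q (sym (Fin.toℕ-injective θ≡t)) q) ¬Qθ

    ps≢wt : ∀ {s t} → Q s → Q t → toℕ s < toℕ t → p s ≢ w t
    ps≢wt {s} {t} qs qt s<t eq with w s Fin.≟ w t
    -- By `same`, sharing its footprint index with a later entry would make that index an anchor.
    ... | yes ws≡wt = free s qs (s , same s<t ws≡wt , refl)
    ... | no  ws≢wt with far s<t ws≢wt
    ...   | inj₁ lt = <⇒≱ lt (≤-trans (≤-reflexive (cong lab (sym eq))) (m≤m+n _ m))
    ...   | inj₂ lt = <⇒≱ lt (≤-trans (≤-reflexive (cong lab eq)) (m≤m+n _ m))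

    ws≢wt : ∀ {s t} → Q s → toℕ s < toℕ t → w s ≢ w t
    ws≢wt {s} qs s<t eq = free s qs (s , same s<t eq , refl)

    ps≢pt : ∀ {s t} → Q s → toℕ s < toℕ t → p s ≢ p t
    -- Were both vertices in one copy, the later footprint would be within m of the earlier vertex.
    ps≢pt {s} {t} qs s<t eq with far s<t (ws≢wt qs s<t)
    ... | inj₁ lt = <⇒≱ lt (subst (λ a → lab (w t) ≤ lab a + m) (sym eq) (w≤p t))
    ... | inj₂ lt = <⇒≱ lt (subst (λ a → lab a ≤ lab (w t) + m) (sym eq) (p≤w t))

    pick-distinct : ∀ {s t} → Q s → Q t → toℕ s < toℕ t → pick s ≢ pick t
    pick-distinct {s} {t} qs qt s<t with toℕ s <? toℕ θ | toℕ t <? toℕ θ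
    ... | yes _ | yes _ = ps≢pt qs s<t
    ... | yes _ | no _  = ps≢wt qs qt s<t
    ... | no _  | no _  = ws≢wt qs s<t
    ... | no s≮θ | yes t<θ = contradiction (<-trans s<t t<θ) s≮θ

    distinct : ∀ {s t} → Q s → Q t → toℕ s < toℕ t → f s ≢ f t
    distinct qs qt s<t eq = pick-distinct qs qt s<t (lab-injective (+-cancelˡ-≡ o _ _ eq))

  module _ {a : Fin n} {θ : Fin T} (pθ : p θ ≡ a) (wθ : w θ ≡ a) where

    -- In all four lemmas `far` supplies the distance from `a`, of `p t` before θ and of `w t` after
    -- it. The side is settled by the position of `w t`, from which `p t` is at most m away.
    early-right : ∀ {t} → toℕ t < toℕ θ → lab a < lab (w t) → lab a + m < lab (p t)
    early-right {t} t<θ a<w with far t<θ (λ eq → <⇒≢ a<w (cong lab (trans (sym wθ) (sym eq))))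
    ... | inj₁ lt = contradiction (<-≤-trans (subst (λ b → lab (p t) + m < lab b) wθ lt) (<⇒≤ a<w))
                      (≤⇒≯ (w≤p t))
    ... | inj₂ lt = subst (λ b → lab b + m < lab (p t)) wθ lt

    early-left : ∀ {t} → toℕ t < toℕ θ → lab (w t) < lab a → lab (p t) + m < lab a
    early-left {t} t<θ w<a with far t<θ (λ eq → <⇒≢ w<a (cong lab (trans eq wθ)))
    ... | inj₁ lt = subst (λ b → lab (p t) + m < lab b) wθ lt
    ... | inj₂ lt = contradiction (<-trans (+-monoˡ-< m w<a) (subst (λ b → lab b + m < lab (p t)) wθ lt))
                      (≤⇒≯ (p≤w t))

    late-right : ∀ {t} → toℕ θ < toℕ t → lab a < lab (w t) → lab a + m < lab (w t)
    late-right {t} θ<t a<w with far θ<t (λ eq → <⇒≢ a<w (cong lab (trans (sym wθ) eq)))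
    ... | inj₁ lt = subst (λ b → lab b + m < lab (w t)) pθ lt
    ... | inj₂ lt = contradiction (<-trans (≤-<-trans (m≤m+n _ m) (subst (λ b → lab (w t) + m < lab b) pθ lt)) a<w)
                      (<-irrefl refl)

    late-left : ∀ {t} → toℕ θ < toℕ t → lab (w t) < lab a → lab (w t) + m < lab a
    late-left {t} θ<t w<a with far θ<t (λ eq → <⇒≢ w<a (cong lab (trans (sym eq) wθ)))
    ... | inj₁ lt = contradiction (<-trans (≤-<-trans (m≤m+n _ m) (subst (λ b → lab b + m < lab (w t)) pθ lt)) w<a)
                      (<-irrefl refl)
    ... | inj₂ lt = subst (λ b → lab (w t) + m < lab b) pθ lt

  Between : Fin n → Fin n → Fin T → Set
  Between a b t = lab a < lab (w t) × lab (w t) < lab b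

  between? : ∀ a b → Decidable (Between a b)
  between? a b t = (lab a <? lab (w t)) ×-dec (lab (w t) <? lab b)

  at? : ∀ a → Decidable (λ t → w t ≡ a)
  at? a t = w t Fin.≟ a

  below? : (a : Fin n) → Decidable (λ t → lab (w t) < lab a)
  below? a t = lab (w t) <? lab a

  above? : (a : Fin n) → Decidable (λ t → lab a < lab (w t))
  above? a t = lab a <? lab (w t)

  from? : (a : Fin n) → Decidable (λ t → lab a ≤ lab (w t))
  from? a t = lab a ≤? lab (w t)

  shift : ∀ {x y} → x + m < y → m + x < y
  shift {x} {y} = subst (_< y) (+-comm x m)

  -- The m missing indices are those next to the earlier anchor: just above `a` if `a` comes first,
  -- just below `b` otherwise.
  count-between : ∀ {a b} → Anchor a → Anchor b →
    (∀ (c : Fin n) → lab a < lab c → lab c < lab b → ¬ Anchor c) →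
    count (between? a b) ≤ lab b ∸ (lab a + suc m)
  count-between {a} {b} (s , ps , ws) (t , pt , wt) gap = case
    where
    free : ∀ r → Between a b r → ¬ Anchor (w r)
    free r (lo , hi) = gap (w r) lo hi

    up : ∀ {x} → lab a + m < x → lab a + suc m ≤ x
    up {x} = subst (_≤ x) (sym (+-suc (lab a) m))

    up′ : ∀ {x} → lab a < x → lab a + suc m ≤ m + x
    up′ {x} lt = subst₂ _≤_ (sym (+-suc (lab a) m)) (+-comm x m) (+-monoˡ-≤ m lt)

    case : count (between? a b) ≤ lab b ∸ (lab a + suc m)
    case with toℕ s <? toℕ t
    ... | yes s<t = count≤interval s 0 (lab a + suc m) (lab b) (between? a b) free
          (λ (lo , _) → <⇒≢ lo (cong lab (sym ws)))
          (λ r (lo , hi) r<s → up (early-right ps ws r<s lo) ,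
            ≤-<-trans (m≤m+n _ m) (early-left pt wt (<-trans r<s s<t) hi))
          (λ r (lo , hi) s<r → up (late-right ps ws s<r lo) , hi)
    -- Here the image lies above `a` and below `lab b - m`; the offset `m` shifts it onto the
    -- interval of the first case.
    ... | no s≮t = count≤interval t m (lab a + suc m) (lab b) (between? a b) free
          (λ (_ , hi) → <⇒≢ hi (cong lab wt))
          (λ r (lo , hi) r<t →
            up′ (≤-<-trans (m≤m+n _ m) (early-right ps ws (<-≤-trans r<t (≮⇒≥ s≮t)) lo)) ,
            shift (early-left pt wt r<t hi))
          (λ r (lo , hi) t<r → up′ lo , shift (late-left pt wt t<r hi))

  -- With no anchor on the left, the gap starts at the end of the path: the indices 1 to
  -- `lab b - m - 1` remain.
  count-below : ∀ {b} → Anchor b → (∀ (c : Fin n) → lab c < lab b → ¬ Anchor c) →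
    count (below? b) ≤ lab b ∸ suc m
  count-below {b} (t , pt , wt) gap = count≤interval t m (suc m) (lab b) (below? b)
    (λ r → gap (w r)) (λ lt → <⇒≢ lt (cong lab wt))
    (λ r hi r<t → pos , shift (early-left pt wt r<t hi))
    (λ r hi t<r → pos , shift (late-left pt wt t<r hi))
    where
    pos : ∀ {x} → suc m ≤ m + suc x
    pos {x} = subst (suc m ≤_) (sym (+-suc m x)) (s≤s (m≤m+n m x))

  count-above : ∀ {a} → Anchor a → (∀ (c : Fin n) → lab a < lab c → ¬ Anchor c) →
    count (above? a) ≤ n ∸ (lab a + m)
  count-above {a} (s , ps , ws) gap = count≤interval s 0 (suc (lab a + m)) (suc n) (above? a)
    (λ r → gap (w r)) (λ lt → <⇒≢ lt (cong lab (sym ws)))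
    (λ r lo r<s → early-right ps ws r<s lo , s≤s (Fin.toℕ<n (p r)))
    (λ r lo s<r → late-right ps ws s<r lo , s≤s (Fin.toℕ<n (w r)))

-- The independent set of anchors

lab-surjective : ∀ {n k} → 1 ≤ k → k ≤ n → ∃ λ (i : Fin n) → lab i ≡ k
lab-surjective {k = suc k} _ k<n = fromℕ< k<n , cong suc (Fin.toℕ-fromℕ< k<n)

Increasing : ∀ {n} → List (Fin n) → Set
Increasing = AllPairs (λ i j → lab i < lab j)

head-least : ∀ {n} {x : Fin n} {ys} → Increasing (x ∷ ys) → ∀ {z} → z ∈ₗ x ∷ ys → lab x ≤ lab z
head-least _         (here refl) = ≤-refl
head-least (x< ∷ _) (there z∈)  = <⇒≤ (All.lookup x< z∈)

above-head : ∀ {n} {x : Fin n} {ys z} → z ∈ₗ x ∷ ys → lab x < lab z → z ∈ₗ ys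
above-head (here refl) lt = contradiction lt (<-irrefl refl)
above-head (there z∈)  _  = z∈

≤maxL : ∀ {k xs} → k ∈ₗ xs → k ≤ maxL xs
≤maxL (here refl) = m≤m⊔n _ _
≤maxL (there k∈)  = ≤-trans (≤maxL k∈) (m≤n⊔m _ _)

module Selection {n m T : ℕ} (tl : Timeline n m T) (m+2≤n : m + 2 ≤ n)
  (g : Fin n → ℕ) (1≤g : ∀ i → 1 ≤ g i)
  (count-at : ∀ a → count (Gaps.at? tl a) ≤ g a)
  (a₀ : Fin n) (anchor-a₀ : Gaps.Anchor tl a₀) where
  open Timeline tl
  open Gaps tl

  2+m≤n : suc (suc m) ≤ n
  2+m≤n = subst (_≤ n) (+-comm m 2) m+2≤n

  1≤n : 1 ≤ n
  1≤n = ≤-trans (s≤s z≤n) 2+m≤n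

  NoneLow NoneHigh : Set
  NoneLow  = ∀ c → Anchor c → suc m < lab c
  NoneHigh = ∀ c → Anchor c → lab c + m < n

  -- The anchors, completed by an endpoint of the path on each side where no anchor is close enough.
  Chosen : Fin n → Set
  Chosen z = Anchor z ⊎ (lab z ≡ 1 × NoneLow) ⊎ (lab z ≡ n × NoneHigh)

  chosen? : Decidable Chosen
  chosen? z = anchor? z ⊎-dec
    (((lab z ≟ 1) ×-dec Fin.all? (λ c → anchor? c →-dec (suc m <? lab c))) ⊎-dec
     ((lab z ≟ n) ×-dec Fin.all? (λ c → anchor? c →-dec (lab c + m <? n))))

  split-at : (x : Fin n) → count (from? x) ≤ count (at? x) + count (above? x)
  split-at x = count-⊎ (from? x) (at? x) (above? x) λ t x≤w → case t (m≤n⇒m<n∨m≡n x≤w)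
    where
    case : ∀ t → lab x < lab (w t) ⊎ lab x ≡ lab (w t) → w t ≡ x ⊎ lab x < lab (w t)
    case t (inj₁ lt) = inj₂ lt
    case t (inj₂ eq) = inj₁ (lab-injective (sym eq))

  split-above : (x y : Fin n) → count (above? x) ≤ count (between? x y) + count (from? y)
  split-above x y = count-⊎ (above? x) (between? x y) (from? y) case
    where
    case : ∀ t → lab x < lab (w t) → Between x y t ⊎ lab y ≤ lab (w t)
    case t lt with lab (w t) <? lab y
    ... | yes lt′ = inj₁ (lt , lt′)
    ... | no  ≮   = inj₂ (≮⇒≥ ≮)

  split-below : {P : Fin T → Set} (P? : Decidable P) (y : Fin n) →
    count P? ≤ count (below? y) + count (from? y)
  split-below P? y = count-⊎ P? (below? y) (from? y) case
    where
    case : ∀ t → _ → lab (w t) < lab y ⊎ lab y ≤ lab (w t)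
    case t _ with lab (w t) <? lab y
    ... | yes lt = inj₁ lt
    ... | no  ≮  = inj₂ (≮⇒≥ ≮)

  -- Invariant for the left end in `count-from`. An added endpoint `n` is excluded, since the anchor
  -- `a₀` lies below it.
  Start : Fin n → Set
  Start x = Anchor x ⊎ (lab x ≡ 1 × NoneLow)

  low-anchors-above : {x : Fin n} → lab x ≡ 1 → NoneLow → ∀ c → Anchor c → lab x < lab c
  low-anchors-above x≡1 low c an = subst (_< lab c) (sym x≡1) (≤-<-trans (s≤s z≤n) (low c an))

  -- If `lab x + m < n`, every anchor, being at or below `x`, is more than m away from `n`; then `n`
  -- itself is chosen and lies above `x`.
  last-close : {x : Fin n} → (∀ z → Chosen z → ¬ lab x < lab z) → n ≤ lab x + m
  last-close {x} last with n ≤? lab x + m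
  ... | yes le = le
  ... | no  n≰ with lab-surjective 1≤n ≤-refl
  ...   | top , top≡n = contradiction (subst (lab x <_) (sym top≡n) (≤-<-trans (m≤m+n _ m) (≰⇒> n≰)))
            (last top (inj₂ (inj₂ (top≡n , λ c an →
              ≤-<-trans (+-monoˡ-≤ m (≮⇒≥ (last c (inj₁ an)))) (≰⇒> n≰)))))

  -- Each gap between consecutive chosen labels costs m; a chosen endpoint that is not an anchor
  -- receives at least 1 on the right-hand side without contributing on the left.
  count-from : ∀ x ys → Increasing (x ∷ ys) → All Chosen (x ∷ ys) →
    (∀ z → Chosen z → lab x < lab z → z ∈ₗ ys) → Start x →
    count (from? x) + length ys * suc m + lab x ≤ sum (map g (x ∷ ys)) + maxL (map lab (x ∷ ys))
  count-from x [] inc _ complete (inj₁ an) = begin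
    count (from? x) + 0 + lab x   ≡⟨ cong (_+ lab x) (+-identityʳ _) ⟩
    count (from? x) + lab x       ≤⟨ +-monoˡ-≤ (lab x) from≤ ⟩
    g x + lab x                   ≡⟨ cong₂ _+_ (+-identityʳ (g x)) (⊔-identityʳ (lab x)) ⟨
    g x + 0 + (lab x ⊔ 0) ∎
    where
    open ≤-Reasoning
    none : ∀ c → lab x < lab c → ¬ Anchor c
    none c lt an′ = contradiction (complete c (inj₁ an′) lt) λ ()
    above≡0 : count (above? x) ≤ 0
    above≡0 = ≤-trans (count-above an none) (≤-reflexive (m≤n⇒m∸n≡0 (last-close λ z ch lt → contradiction (complete z ch lt) λ ())))
    from≤ : count (from? x) ≤ g x
    from≤ = ≤-trans (split-at x) (≤-trans (+-mono-≤ (count-at x) above≡0) (≤-reflexive (+-identityʳ _)))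
  -- An added endpoint 1 is never the last chosen vertex, because `NoneLow` puts `a₀` above it.
  count-from x [] _ _ complete (inj₂ (x≡1 , low)) =
    contradiction (complete a₀ (inj₁ anchor-a₀) (low-anchors-above x≡1 low a₀ anchor-a₀)) λ ()
  count-from x (y ∷ ys) (x< ∷ inc) (_ ∷ inj₁ an-y ∷ chosen) complete st = begin
    C x + (suc m + length ys * suc m) + lab x                    ≤⟨ step st ⟩
    g x + (C y + length ys * suc m + lab y)                      ≤⟨ +-monoʳ-≤ (g x) ih ⟩
    g x + (sum (map g (y ∷ ys)) + maxL (map lab (y ∷ ys)))       ≡⟨ +-assoc (g x) _ _ ⟨
    g x + sum (map g (y ∷ ys)) + maxL (map lab (y ∷ ys))         ≤⟨ +-monoʳ-≤ (g x + sum (map g (y ∷ ys))) (m≤n⊔m (lab x) _) ⟩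
    g x + sum (map g (y ∷ ys)) + maxL (map lab (x ∷ y ∷ ys))     ∎
    where
    open ≤-Reasoning
    C : Fin n → ℕ
    C z = count (from? z)
    x<y : lab x < lab y
    x<y = All.head x<
    gap : ∀ c → lab x < lab c → lab c < lab y → ¬ Anchor c
    gap c lo hi an = <⇒≱ hi (head-least inc (complete c (inj₁ an) lo))
    ih : C y + length ys * suc m + lab y ≤ sum (map g (y ∷ ys)) + maxL (map lab (y ∷ ys))
    ih = count-from y ys inc (inj₁ an-y ∷ chosen)
           (λ z ch y<z → above-head (complete z ch (<-trans x<y y<z)) y<z) (inj₁ an-y)
    arrange : ∀ a b c l s k → a + b + c + (s + l) + k ≡ a + (c + l + (b + (k + s)))
    arrange = solve-∀
    step : Start x → C x + (suc m + length ys * suc m) + lab x ≤ g x + (C y + length ys * suc m + lab y)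
    step (inj₁ an) = begin
      C x + (suc m + length ys * suc m) + lab x
        ≤⟨ +-monoˡ-≤ (lab x) (+-monoˡ-≤ _ (≤-trans (split-at x) (+-mono-≤ (count-at x) (split-above x y)))) ⟩
      g x + (count (between? x y) + C y) + (suc m + length ys * suc m) + lab x
        ≡⟨ cong (λ k → k + (suc m + length ys * suc m) + lab x) (+-assoc (g x) _ _) ⟨
      g x + count (between? x y) + C y + (suc m + length ys * suc m) + lab x
        ≡⟨ arrange (g x) (count (between? x y)) (C y) (length ys * suc m) (suc m) (lab x) ⟩
      g x + (C y + length ys * suc m + (count (between? x y) + (lab x + suc m)))
        ≤⟨ +-monoʳ-≤ (g x) (+-monoʳ-≤ (C y + length ys * suc m)
             (m≤o∸n⇒m+n≤o _ (subst (_≤ lab y) (sym (+-suc (lab x) m)) (anchors-gap an an-y x<y))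
               (count-between an an-y gap))) ⟩
      g x + (C y + length ys * suc m + lab y) ∎
    -- Vertex 1 is no anchor, so entries footprinted there are already counted by `count-below`. The
    -- summand `lab x`, which is 1, is paid for by `1 ≤ g x`.
    step (inj₂ (x≡1 , low)) = begin
      C x + (suc m + length ys * suc m) + lab x
        ≤⟨ +-monoˡ-≤ (lab x) (+-monoˡ-≤ _ (split-below (from? x) y)) ⟩
      count (below? y) + C y + (suc m + length ys * suc m) + lab x
        ≡⟨ arrange 0 (count (below? y)) (C y) (length ys * suc m) (suc m) (lab x) ⟩
      C y + length ys * suc m + (count (below? y) + (lab x + suc m))
        ≡⟨ cong (λ k → C y + length ys * suc m + k) (swap-sum (count (below? y)) (lab x) (suc m)) ⟩
      C y + length ys * suc m + (lab x + (count (below? y) + suc m))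
        ≡⟨ swap-sum (C y + length ys * suc m) (lab x) (count (below? y) + suc m) ⟩
      lab x + (C y + length ys * suc m + (count (below? y) + suc m))
        ≤⟨ +-mono-≤ (subst (_≤ g x) (sym x≡1) (1≤g x)) (+-monoʳ-≤ (C y + length ys * suc m)
             (m≤o∸n⇒m+n≤o _ (<⇒≤ (low y an-y))
               (count-below an-y (λ c c<y an → gap c (low-anchors-above x≡1 low c an) c<y an)))) ⟩
      g x + (C y + length ys * suc m + lab y) ∎
      where
      swap-sum : ∀ a b c → a + (b + c) ≡ b + (a + c)
      swap-sum = solve-∀
  count-from x (y ∷ ys) (x< ∷ _) (_ ∷ inj₂ (inj₁ (y≡1 , _)) ∷ _) _ _ =
    contradiction (subst (lab x <_) y≡1 (All.head x<)) λ { (s≤s ()) }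
  count-from x (y ∷ z ∷ _) (_ ∷ (y< ∷ _)) (_ ∷ inj₂ (inj₂ (y≡n , _)) ∷ _) _ _ =
    contradiction (Fin.toℕ<n z) (<⇒≱ (subst (_< lab z) y≡n (All.head y<)))
  -- Vertex `n` is no anchor, so `count-above` includes it among the possible indices. This is one
  -- more than for a gap ending at an anchor, and `1 ≤ g y` pays for it.
  count-from x (y ∷ []) _ (_ ∷ inj₂ (inj₂ (y≡n , high)) ∷ _) complete (inj₁ an) = begin
    count (from? x) + (suc m + 0) + lab x
      ≤⟨ +-monoˡ-≤ (lab x) (+-monoˡ-≤ (suc m + 0) (≤-trans (split-at x)
           (+-mono-≤ (count-at x) (count-above an none)))) ⟩
    g x + (n ∸ (lab x + m)) + (suc m + 0) + lab x
      ≡⟨ arrange (g x) (n ∸ (lab x + m)) m (lab x) ⟩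
    g x + 1 + (n ∸ (lab x + m) + (lab x + m))
      ≡⟨ cong (λ k → g x + 1 + k) (m∸n+n≡m (<⇒≤ (high x an))) ⟩
    g x + 1 + n
      ≤⟨ +-mono-≤ (+-monoʳ-≤ (g x) (≤-trans (1≤g y) (m≤m+n (g y) 0)))
           (subst (_≤ maxL (map lab (x ∷ y ∷ []))) y≡n (≤maxL {xs = lab x ∷ lab y ∷ []} (there (here refl)))) ⟩
    g x + (g y + 0) + maxL (map lab (x ∷ y ∷ [])) ∎
    where
    open ≤-Reasoning
    arrange : ∀ a b s k → a + b + (suc s + 0) + k ≡ a + 1 + (b + (k + s))
    arrange = solve-∀
    none : ∀ c → lab x < lab c → ¬ Anchor c
    none c lt an′ with complete c (inj₁ an′) lt
    ... | here refl = <⇒≱ (high c an′) (subst (_≤ lab c + m) y≡n (m≤m+n _ m))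
  -- The two added endpoints cannot be the only vertices: `a₀` would have to be `n`, contrary to
  -- `NoneHigh`.
  count-from x (y ∷ []) _ (_ ∷ inj₂ (inj₂ (y≡n , high)) ∷ _) complete (inj₂ (x≡1 , low))
    with complete a₀ (inj₁ anchor-a₀) (low-anchors-above x≡1 low a₀ anchor-a₀)
  ... | here refl = contradiction (high y anchor-a₀) (≤⇒≯ (subst (_≤ lab y + m) y≡n (m≤m+n _ m)))

  module _ {x : Fin n} {ys : List (Fin n)} (inc : Increasing (x ∷ ys)) (chosen : All Chosen (x ∷ ys))
    (complete : ∀ z → Chosen z → z ∈ₗ x ∷ ys) where

    head≤1+m : lab x ≤ suc m
    head≤1+m with lab x ≤? suc m
    ... | yes le = le
    ... | no  x≰ with lab-surjective (s≤s z≤n) 1≤n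
    ...   | one , one≡1 = contradiction (≤-trans (subst (lab x ≤_) one≡1 (head-least inc
              (complete one (inj₂ (inj₁ (one≡1 ,
                λ c an → <-≤-trans (≰⇒> x≰) (head-least inc (complete c (inj₁ an))))))))) (s≤s z≤n)) x≰

    n≤max+m : n ≤ maxL (map lab (x ∷ ys)) + m
    n≤max+m with Fin.any? (λ c → anchor? c ×-dec (n ≤? lab c + m))
    ... | yes (c , an , le) = ≤-trans le (+-monoˡ-≤ m (≤maxL (∈-map⁺ lab (complete c (inj₁ an)))))
    ... | no none with lab-surjective 1≤n ≤-refl
    ...   | top , top≡n = ≤-trans (subst (_≤ maxL (map lab (x ∷ ys))) top≡n
              (≤maxL (∈-map⁺ lab (complete top (inj₂ (inj₂ (top≡n , λ c an → ≰⇒> (λ le → none (c , an , le)))))))))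
              (m≤m+n _ m)

    start : Start x
    start with All.head chosen
    ... | inj₁ an = inj₁ an
    ... | inj₂ (inj₁ low) = inj₂ low
    ... | inj₂ (inj₂ (x≡n , high)) = contradiction (head-least inc (complete a₀ (inj₁ anchor-a₀)))
            (<⇒≱ (≤-<-trans (m≤m+n (lab a₀) m) (subst (lab a₀ + m <_) (sym x≡n) (high a₀ anchor-a₀))))

    -- Below a first anchor, `count-below` leaves room for `lab x ∸ suc m` entries, which is 0 by
    -- `head≤1+m`.
    none-below : count (below? x) ≡ 0
    none-below with start
    ... | inj₁ an = n≤0⇒n≡0 (≤-trans
            (count-below an (λ c c<x an′ → <⇒≱ c<x (head-least inc (complete c (inj₁ an′)))))
            (≤-reflexive (m≤n⇒m∸n≡0 head≤1+m)))
    ... | inj₂ (x≡1 , _) = count-∅ (below? x) λ t lt → contradiction (subst (lab (w t) <_) x≡1 lt) λ { (s≤s ()) }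

    length-bound : T + length ys * suc m + lab x ≤ sum (map g (x ∷ ys)) + maxL (map lab (x ∷ ys))
    length-bound = ≤-trans (+-monoˡ-≤ (lab x) (+-monoˡ-≤ (length ys * suc m) T≤))
      (count-from x ys inc chosen (λ z ch x<z → above-head (complete z ch) x<z) start)
      where
      all? : Decidable {A = Fin T} (λ _ → ⊤)
      all? _ = yes tt
      T≤ : T ≤ count (from? x)
      T≤ = begin
        T                                   ≡⟨ length-tabulate id ⟨
        length (allFin T)                   ≡⟨ cong length (filter-all all? (All.tabulate⁺ {f = id} (λ _ → tt))) ⟨
        count all?                          ≤⟨ split-below all? x ⟩
        count (below? x) + count (from? x)  ≡⟨ cong (_+ count (from? x)) none-below ⟩
        count (from? x)                     ∎
        where open ≤-Reasoning

  chosen-far : ∀ {y z} → Chosen y → Chosen z → lab y < lab z → lab y + m < lab z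
  chosen-far (inj₁ an) (inj₁ an′) lt = anchors-gap an an′ lt
  chosen-far {y} {z} (inj₂ (inj₁ (y≡1 , low))) (inj₁ an) _ = subst (λ k → k + m < lab z) (sym y≡1) (low z an)
  chosen-far {y} (inj₁ an) (inj₂ (inj₂ (z≡n , high))) _ = subst (lab y + m <_) (sym z≡n) (high y an)
  chosen-far {y} {z} (inj₂ (inj₁ (y≡1 , _))) (inj₂ (inj₂ (z≡n , _))) _ =
    -- The hypothesis `m + 2 ≤ n` says precisely that the two ends of the path are nonadjacent.
    subst₂ (λ k l → k + m < l) (sym y≡1) (sym z≡n) 2+m≤n
  chosen-far {y} _ (inj₂ (inj₁ (z≡1 , _))) lt = contradiction (subst (lab y <_) z≡1 lt) λ { (s≤s ()) }
  chosen-far {z = z} (inj₂ (inj₂ (y≡n , _))) _ lt =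
    contradiction (Fin.toℕ<n z) (<⇒≱ (subst (_< lab z) y≡n lt))

-- Joins over path powers; the objective

Near : ∀ {n} → ℕ → Fin n → Fin n → Set
Near m i j = lab i ≤ lab j + m × lab j ≤ lab i + m

near-or-far : ∀ {n} (m : ℕ) (i j : Fin n) → Near m i j ⊎ (lab i + m < lab j ⊎ lab j + m < lab i)
near-or-far m i j with lab i ≤? lab j + m | lab j ≤? lab i + m
... | yes le | yes le′ = inj₁ (le , le′)
... | no ≰   | _       = inj₂ (inj₂ (≰⇒> ≰))
... | yes _  | no ≰    = inj₂ (inj₁ (≰⇒> ≰))

adj⇒near : ∀ {n m} {i j : Fin n} → pathPowAdj n m i j ≡ true → i ≢ j × Near m i j
adj⇒near {n} {m} {i} {j} adj with Equivalence.to Bool.T-∧ (Equivalence.from Bool.T-≡ adj)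
... | pos , close =
  (λ { refl → <⇒≢ (<ᵇ⇒< 0 _ pos) (sym (∣n-n∣≡0 (toℕ i))) }) ,
  s≤s (≤-trans (m≤n+∣m-n∣ (toℕ i) (toℕ j)) (+-monoʳ-≤ (toℕ j) (≤ᵇ⇒≤ _ m close))) ,
  s≤s (≤-trans (m≤n+∣n-m∣ (toℕ j) (toℕ i)) (+-monoʳ-≤ (toℕ i) (≤ᵇ⇒≤ _ m close)))

near⇒adj : ∀ {n m} {i j : Fin n} → i ≢ j → Near m i j → pathPowAdj n m i j ≡ true
near⇒adj {n} {m} {i} {j} i≢j (s≤s i≤ , s≤s j≤) =
  Equivalence.to Bool.T-≡ (Equivalence.from Bool.T-∧
    (<⇒<ᵇ (n≢0⇒n>0 (λ eq → i≢j (Fin.toℕ-injective (∣m-n∣≡0⇒m≡n eq)))) , ≤⇒≤ᵇ close))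
  where
  close : ∣ toℕ i - toℕ j ∣ ≤ m
  close with ∣m-n∣≡[m∸n]∨[n∸m] (toℕ i) (toℕ j)
  ... | inj₁ eq = ≤-trans (≤-reflexive eq) (m≤n+o⇒m∸n≤o (toℕ i) (toℕ j) i≤)
  ... | inj₂ eq = ≤-trans (≤-reflexive eq) (m≤n+o⇒m∸n≤o (toℕ j) (toℕ i) j≤)

module JoinGraph (n m : ℕ) (R : Fin n → FinGraph) where
  G⋈R : Graph
  G⋈R = Join n m R

  join-cross : {a b : V G⋈R} → proj₁ a ≢ proj₁ b → Near m (proj₁ a) (proj₁ b) → InN G⋈R a b
  join-cross {i , x} {j , y} i≢j near = inj₂ adjacent
    where
    adjacent : joinAdj n m R (i , x) (j , y) ≡ true
    adjacent with i Fin.≟ j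
    ... | yes i≡j = contradiction i≡j i≢j
    ... | no _    = near⇒adj i≢j near

  near-refl : (i : Fin n) → Near m i i
  near-refl i = m≤m+n _ m , m≤m+n _ m

  join-near : {a b : V G⋈R} → InN G⋈R a b → Near m (proj₁ a) (proj₁ b)
  join-near {i , _} (inj₁ refl) = near-refl i
  join-near {i , x} {j , y} (inj₂ adj) with i Fin.≟ j
  ... | yes refl = near-refl i
  ... | no _     = proj₂ (adj⇒near adj)

  joinAdj-fibre : ∀ i x y → joinAdj n m R (i , x) (i , y) ≡ fadj (R i) x y
  joinAdj-fibre i x y with i Fin.≟ i
  ... | yes refl = refl
  ... | no i≢i   = contradiction refl i≢i

  fibre⇒join : ∀ {i x y} → InN (toGraph (R i)) x y → InN G⋈R (i , x) (i , y)
  fibre⇒join (inj₁ refl) = inj₁ refl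
  fibre⇒join (inj₂ adj)  = inj₂ (trans (joinAdj-fibre _ _ _) adj)

  join⇒fibre : ∀ {i x y} → InN G⋈R (i , x) (i , y) → InN (toGraph (R i)) x y
  join⇒fibre (inj₁ refl) = inj₁ refl
  join⇒fibre (inj₂ adj)  = inj₂ (trans (sym (joinAdj-fibre _ _ _)) adj)

  _≟ⱽ_ : (a b : V G⋈R) → Dec (a ≡ b)
  (i , x) ≟ⱽ (j , y) with i Fin.≟ j
  ... | no i≢j = no λ { refl → i≢j refl }
  ... | yes refl with x Fin.≟ y
  ...   | yes refl = yes refl
  ...   | no x≢y   = no λ { refl → x≢y refl }

  InN? : ∀ a b → Dec (InN G⋈R a b)
  InN? a b = (b ≟ⱽ a) ⊎-dec (joinAdj n m R a b Bool.≟ true)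

  -- Any footprint of v t may be replaced by v t itself when v t was not yet dominated. With this
  -- choice, v s lies in the copy containing a later footprint u t only if u s does as well.
  module Footprints {T : ℕ} (v u : Fin T → V G⋈R) (near : ∀ t → InN G⋈R (v t) (u t))
    (sep : ∀ {s t} → toℕ s < toℕ t → ¬ InN G⋈R (v s) (u t))
    (canonical : ∀ t → u t ≡ v t ⊎ ∃ λ s → toℕ s < toℕ t × InN G⋈R (v s) (v t)) where

    timeline : Timeline n m T
    timeline = record
      { p    = proj₁ ∘ v
      ; w    = proj₁ ∘ u
      ; p≤w  = λ t → proj₁ (join-near (near t))
      ; w≤p  = λ t → proj₂ (join-near (near t))
      ; far  = far′
      ; same = same′
      }
      where
      -- A vertex outside the copy of its footprint is adjacent to that entire copy, so no later
      -- footprint can lie there.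
      same′ : ∀ {s t} → toℕ s < toℕ t → proj₁ (u s) ≡ proj₁ (u t) → proj₁ (v s) ≡ proj₁ (u s)
      same′ {s} {t} s<t eq with proj₁ (v s) Fin.≟ proj₁ (u s)
      ... | yes same = same
      ... | no  ≢    = contradiction
              (join-cross (subst (proj₁ (v s) ≢_) eq ≢) (subst (Near m (proj₁ (v s))) eq (join-near (near s))))
              (sep s<t)

      -- Suppose `v r` dominated `v s` earlier and `u s` lies outside the copy of `v s`. If `v r` is
      -- in another copy than `v s`, it dominates the whole copy of `v s`, hence `u t`; if it is in
      -- the same copy, it dominates the whole copy of `u s`. Both contradict `sep`.
      shared : ∀ {s t} → toℕ s < toℕ t → proj₁ (v s) ≡ proj₁ (u t) → proj₁ (u s) ≡ proj₁ (u t)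
      shared {s} {t} s<t eq with canonical s
      ... | inj₁ u≡v = trans (cong proj₁ u≡v) eq
      ... | inj₂ (r , r<s , dom) = case (proj₁ (v r) Fin.≟ proj₁ (v s)) (proj₁ (u s) Fin.≟ proj₁ (v s))
        where
        case : Dec (proj₁ (v r) ≡ proj₁ (v s)) → Dec (proj₁ (u s) ≡ proj₁ (v s)) → proj₁ (u s) ≡ proj₁ (u t)
        case _ (yes u≡s) = trans u≡s eq
        case (no r≢s) _ = contradiction
          (join-cross (subst (proj₁ (v r) ≢_) eq r≢s) (subst (Near m (proj₁ (v r))) eq (join-near dom)))
          (sep (<-trans r<s s<t))
        case (yes r≡s) (no u≢s) = contradiction
          (join-cross (λ r≡u → u≢s (trans (sym r≡u) r≡s))
            (subst (λ i → Near m i (proj₁ (u s))) (sym r≡s) (join-near (near s))))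
          (sep r<s)

      far′ : ∀ {s t} → toℕ s < toℕ t → proj₁ (u s) ≢ proj₁ (u t) →
        lab (proj₁ (v s)) + m < lab (proj₁ (u t)) ⊎ lab (proj₁ (u t)) + m < lab (proj₁ (v s))
      far′ {s} {t} s<t u≢u with near-or-far m (proj₁ (v s)) (proj₁ (u t))
      ... | inj₂ far = far
      ... | inj₁ close = contradiction (join-cross (λ eq → u≢u (shared s<t eq)) close) (sep s<t)

    open Timeline timeline using (same)
    open Gaps timeline using (at?)

    module Fibre (a : Fin n) (default : Fin (size (R a))) where
      coerce : V G⋈R → Fin (size (R a))
      coerce (i , x) with i Fin.≟ a
      ... | yes refl = x
      ... | no _     = default

      coerce-≡ : {b : V G⋈R} → proj₁ b ≡ a → (a , coerce b) ≡ b
      coerce-≡ {i , x} i≡a with i Fin.≟ a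
      ... | yes refl = refl
      ... | no i≢a   = contradiction i≡a i≢a

      -- By `same`, only the last entry footprinted in copy `a` can have its vertex elsewhere.
      -- Replacing that vertex by its own footprint disturbs no later entry.
      inside : Fin T → Fin (size (R a))
      inside t with proj₁ (v t) Fin.≟ a
      ... | yes _ = coerce (v t)
      ... | no  _ = coerce (u t)

      inside-≡ : ∀ {t} → proj₁ (v t) ≡ a → (a , inside t) ≡ v t
      inside-≡ {t} v∈a with proj₁ (v t) Fin.≟ a
      ... | yes _  = coerce-≡ v∈a
      ... | no v∉a = contradiction v∈a v∉a

      inside-near : ∀ {t} → proj₁ (u t) ≡ a → InN (toGraph (R a)) (inside t) (coerce (u t))
      inside-near {t} u∈a with proj₁ (v t) Fin.≟ a
      ... | no _    = inj₁ refl
      ... | yes v∈a = join⇒fibre (subst₂ (InN G⋈R) (sym (coerce-≡ v∈a)) (sym (coerce-≡ u∈a)) (near t))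

      inside-sep : ∀ {s t} → proj₁ (u s) ≡ a → proj₁ (u t) ≡ a → toℕ s < toℕ t →
        ¬ InN (toGraph (R a)) (inside s) (coerce (u t))
      inside-sep s∈a t∈a s<t inN = sep s<t (subst₂ (InN G⋈R)
        (inside-≡ (trans (same s<t (trans s∈a (sym t∈a))) s∈a)) (coerce-≡ t∈a) (fibre⇒join inN))

      count-at≤ : ∀ {k} → IsGrundyNumber (toGraph (R a)) k → count (at? a) ≤ k
      count-at≤ grundy = subst (_≤ _) (length-map (λ t → inside t , coerce (u t)) (filter (at? a) (allFin T)))
        (witnessed-length≤ (R a) grundy
          ( All.map⁺ (All.map inside-near (All.all-filter (at? a) (allFin T)))
          , AllPairs.map⁺ (AllPairs-filter-allFin (at? a) inside-sep)))

module _ {n : ℕ} (I : Subset n) where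

  ∈elems⁺ : ∀ {z} → vlookup I z ≡ true → z ∈ₗ elems I
  ∈elems⁺ {z} z∈ = ∈-filter⁺ (λ x → T? (vlookup I x)) (∈-allFin z) (Equivalence.from Bool.T-≡ z∈)

  ∈elems⁻ : ∀ {z} → z ∈ₗ elems I → vlookup I z ≡ true
  ∈elems⁻ {z} z∈ = Equivalence.to Bool.T-≡
    (proj₂ (∈-filter⁻ (λ x → T? (vlookup I x)) {xs = allFin n} z∈))

  elems-increasing : Increasing (elems I)
  elems-increasing = AllPairs-filter-allFin (λ x → T? (vlookup I x)) (λ _ _ → s≤s)

length-filterᵇ-map : {A B : Set} (f : A → B) (P : B → Bool) (xs : List A) →
  length (filterᵇ P (map f xs)) ≡ length (filterᵇ (P ∘ f) xs)
length-filterᵇ-map f P [] = refl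
length-filterᵇ-map f P (x ∷ xs) with P (f x)
... | true  = cong suc (length-filterᵇ-map f P xs)
... | false = length-filterᵇ-map f P xs

length-elems : ∀ {n} (I : Subset n) → length (elems I) ≡ ∣ I ∣
length-elems [] = refl
length-elems {suc n} (b ∷ I) = head-case b (trans
  (cong (length ∘ filterᵇ (vlookup (b ∷ I))) (sym (map-tabulate {n = n} id suc)))
  (trans (length-filterᵇ-map suc (vlookup (b ∷ I)) (allFin n)) (length-elems I)))
  where
  head-case : ∀ c → length (filterᵇ (vlookup (c ∷ I)) (tabulate suc)) ≡ ∣ I ∣ →
    length (elems (c ∷ I)) ≡ ∣ c ∷ I ∣
  head-case true  = cong suc
  head-case false = id

minL-increasing : ∀ {n} {x : Fin n} {ys} → Increasing (x ∷ ys) → minL (map lab (x ∷ ys)) ≡ lab x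
minL-increasing {x = x} (x< ∷ _) = go x<
  where
  go : ∀ {zs} → All (λ z → lab x < lab z) zs → foldr _⊓_ (lab x) (map lab zs) ≡ lab x
  go [] = refl
  go (x<z ∷ x<zs) = trans (cong (_ ⊓_) (go x<zs)) (m≥n⇒m⊓n≡n (<⇒≤ x<z))

foldr-pred : ∀ {n} (g : Fin n → ℕ) xs →
  foldr _+ℤ_ (+ 0) (map (λ i → (+ g i) -ℤ (+ 1)) xs) ≡ (+ sum (map g xs)) -ℤ (+ length xs)
foldr-pred g [] = refl
foldr-pred g (x ∷ xs) = trans (cong (((+ g x) -ℤ (+ 1)) +ℤ_) (foldr-pred g xs))
  (arrange (+ g x) (+ sum (map g xs)) (+ length xs))
  where
  arrange : ∀ a s l → (a -ℤ (+ 1)) +ℤ (s -ℤ l) ≡ (a +ℤ s) -ℤ ((+ 1) +ℤ l)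
  arrange = ℤ-Solver.solve-∀

-- Together with `m + 1`, the added summand cancels every negative term, as I has `suc (length ys)`
-- members and least label `lab x`. Both bounds are proved in this subtraction-free form.
objective-clear : ∀ {n} (m : ℕ) (g : Fin n → ℕ) (I : Subset n) {x ys} → elems I ≡ x ∷ ys →
  objective n m g I +ℤ (+ (m + 1)) +ℤ (+ (length ys * suc m + lab x)) ≡
  + (sum (map g (x ∷ ys)) + maxL (map lab (x ∷ ys)))
objective-clear {n} m g I {x} {ys} eq = begin
  foldr _+ℤ_ (+ 0) (map (λ i → (+ g i) -ℤ (+ 1)) (elems I)) +ℤ (+ MI I) -ℤ (+ mI I) -ℤ (+ (∣ I ∣ * m))
    +ℤ (+ (m + 1)) +ℤ B
    ≡⟨ cong (λ k → foldr _+ℤ_ (+ 0) (map (λ i → (+ g i) -ℤ (+ 1)) (elems I)) +ℤ (+ MI I) -ℤ (+ mI I)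
         -ℤ (+ (k * m)) +ℤ (+ (m + 1)) +ℤ B) (sym (length-elems I)) ⟩
  value (elems I)
    ≡⟨ cong value eq ⟩
  value (x ∷ ys)
    ≡⟨ cong (λ k → foldr _+ℤ_ (+ 0) (map (λ i → (+ g i) -ℤ (+ 1)) (x ∷ ys)) +ℤ (+ M) -ℤ (+ k)
         -ℤ (+ (suc (length ys) * m)) +ℤ (+ (m + 1)) +ℤ B)
         (minL-increasing (subst Increasing eq (elems-increasing I))) ⟩
  foldr _+ℤ_ (+ 0) (map (λ i → (+ g i) -ℤ (+ 1)) (x ∷ ys)) +ℤ (+ M) -ℤ (+ lab x)
    -ℤ (+ (suc (length ys) * m)) +ℤ (+ (m + 1)) +ℤ B
    ≡⟨ cong (λ k → k +ℤ (+ M) -ℤ (+ lab x) -ℤ (+ (suc (length ys) * m)) +ℤ (+ (m + 1)) +ℤ B)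
         (foldr-pred g (x ∷ ys)) ⟩
  (+ Σg) -ℤ (+ suc (length ys)) +ℤ (+ M) -ℤ (+ lab x) -ℤ (+ (suc (length ys) * m)) +ℤ (+ (m + 1)) +ℤ B
    ≡⟨ cong₂ (λ k l → (+ Σg) -ℤ (+ suc (length ys)) +ℤ (+ M) -ℤ (+ lab x) -ℤ k +ℤ (+ (m + 1)) +ℤ (l +ℤ (+ lab x)))
         (ℤ.pos-* (suc (length ys)) m) (ℤ.pos-* (length ys) (suc m)) ⟩
  (+ Σg) -ℤ ((+ 1) +ℤ (+ length ys)) +ℤ (+ M) -ℤ (+ lab x) -ℤ (((+ 1) +ℤ (+ length ys)) *ℤ (+ m))
    +ℤ ((+ m) +ℤ (+ 1)) +ℤ ((+ length ys) *ℤ ((+ 1) +ℤ (+ m)) +ℤ (+ lab x))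
    ≡⟨ arrange (+ Σg) (+ length ys) (+ M) (+ lab x) (+ m) ⟩
  + (Σg + M) ∎
  where
  open ≡-Reasoning
  Σg M : ℕ
  Σg = sum (map g (x ∷ ys))
  M  = maxL (map lab (x ∷ ys))
  B : ℤ
  B = + (length ys * suc m + lab x)
  value : List (Fin n) → ℤ
  value zs = foldr _+ℤ_ (+ 0) (map (λ i → (+ g i) -ℤ (+ 1)) zs) +ℤ (+ maxL (map lab zs))
    -ℤ (+ minL (map lab zs)) -ℤ (+ (length zs * m)) +ℤ (+ (m + 1)) +ℤ B
  arrange : ∀ s l M x m → s -ℤ ((+ 1) +ℤ l) +ℤ M -ℤ x -ℤ (((+ 1) +ℤ l) *ℤ m) +ℤ (m +ℤ (+ 1))
    +ℤ (l *ℤ ((+ 1) +ℤ m) +ℤ x) ≡ s +ℤ M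
  arrange = ℤ-Solver.solve-∀

-- Upper bound

+-cancel-≤ℤ : ∀ {i j : ℤ} (k : ℤ) → i +ℤ k ≤ℤ j +ℤ k → i ≤ℤ j
+-cancel-≤ℤ {i} {j} k le = subst₂ _≤ℤ_ (undo i k) (undo j k) (ℤ.+-monoˡ-≤ (- k) le)
  where
  undo : ∀ a b → a +ℤ b +ℤ (- b) ≡ a
  undo = ℤ-Solver.solve-∀

labels-apart⇒independent : ∀ {n m} (I : Subset n) →
  (∀ {y z} → vlookup I y ≡ true → vlookup I z ≡ true → lab y < lab z → lab y + m < lab z) →
  Independent (PathPow n m) (λ z → z ∈ I)
labels-apart⇒independent {n} {m} I apart y z y∈ z∈ = Bool.¬-not λ adj →
  let y≢z , y≤ , z≤ = adj⇒near {n} {m} adj in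
  case adj y≢z y≤ z≤ (<-cmp (lab y) (lab z))
  where
  case : pathPowAdj n m y z ≡ true → y ≢ z → lab y ≤ lab z + m → lab z ≤ lab y + m → _ → ⊥
  case _ _ _ z≤ (tri< lt _ _) = <⇒≱ (apart (Vec.[]=⇒lookup y∈) (Vec.[]=⇒lookup z∈) lt) z≤
  case _ y≢z _ _ (tri≈ _ eq _) = y≢z (lab-injective eq)
  case _ _ y≤ _ (tri> _ _ gt) = <⇒≱ (apart (Vec.[]=⇒lookup z∈) (Vec.[]=⇒lookup y∈) gt) y≤

module UpperBound (n m : ℕ) (m+2≤n : m + 2 ≤ n) (R : Fin n → FinGraph) (g : Fin n → ℕ)
  (grundy : ∀ i → IsGrundyNumber (toGraph (R i)) (g i)) where
  open JoinGraph n m R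

  some-vertex : ∀ i → Fin (size (R i))
  some-vertex i = fromℕ< (nonempty (R i))

  1≤g : ∀ i → 1 ≤ g i
  1≤g i with grundy i
  ... | (S , (_ , dom , _) , len) , _ with dom (some-vertex i)
  ...   | _ , v∈ , _ = subst (1 ≤_) len (∈-length v∈)

  length≤objective : (S : List (V G⋈R)) → LegalDom G⋈R S →
    ∃ λ I → InItilde n m I × + length S ≤ℤ objective n m g I +ℤ (+ (m + 1))
  length≤objective S (_ , dom , footprint) = bound (elems I) refl
    where
    T : ℕ
    T = length S

    Dominated : Fin T → Set
    Dominated t = ∃ λ s → toℕ s < toℕ t × InN G⋈R (lookup S s) (lookup S t)

    dominated? : ∀ t → Dec (Dominated t)
    dominated? t = Fin.any? (λ s → (toℕ s <? toℕ t) ×-dec InN? (lookup S s) (lookup S t))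

    choose : ∀ t → Dec (Dominated t) → V G⋈R
    choose t (yes _) = proj₁ (footprint t)
    choose t (no _)  = lookup S t

    u : Fin T → V G⋈R
    u t = choose t (dominated? t)

    near : ∀ t → InN G⋈R (lookup S t) (u t)
    near t = go (dominated? t)
      where
      go : ∀ d → InN G⋈R (lookup S t) (choose t d)
      go (yes _) = proj₁ (proj₂ (footprint t))
      go (no _)  = inj₁ refl

    sep : ∀ {s t} → toℕ s < toℕ t → ¬ InN G⋈R (lookup S s) (u t)
    sep {s} {t} s<t = go (dominated? t)
      where
      go : ∀ d → ¬ InN G⋈R (lookup S s) (choose t d)
      go (yes _) = proj₂ (proj₂ (footprint t)) s s<t
      go (no ¬d) = λ inN → ¬d (s , s<t , inN)

    canonical : ∀ t → u t ≡ lookup S t ⊎ Dominated t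
    canonical t = go (dominated? t)
      where
      go : ∀ d → choose t d ≡ lookup S t ⊎ Dominated t
      go (yes d) = inj₂ d
      go (no _)  = inj₁ refl

    open Footprints (lookup S) u near sep canonical

    -- Nothing precedes the first entry, so `canonical` makes it its own footprint. That there is a
    -- first entry follows from the domination of `vertex`.
    anchored : ∃ (Gaps.Anchor timeline)
    anchored = go (canonical first)
      where
      vertex : V G⋈R
      vertex = fromℕ< (≤-trans (s≤s z≤n) (m+n≤o⇒n≤o m m+2≤n)) , some-vertex _
      1≤T : 1 ≤ T
      1≤T = ∈-length (proj₁ (proj₂ (dom vertex)))
      first : Fin T
      first = fromℕ< 1≤T
      go : u first ≡ lookup S first ⊎ Dominated first → ∃ (Gaps.Anchor timeline)
      go (inj₁ eq) = _ , first , refl , cong proj₁ eq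
      go (inj₂ (s , s<first , _)) =
        contradiction (subst (toℕ s <_) (Fin.toℕ-fromℕ< 1≤T) s<first) λ ()

    open Selection timeline m+2≤n g 1≤g (λ a → Fibre.count-at≤ a (some-vertex a) (grundy a))
      (proj₁ anchored) (proj₂ anchored)

    I : Subset n
    I = Vec.tabulate (does ∘ chosen?)

    ∈I⇒chosen : ∀ {z} → vlookup I z ≡ true → Chosen z
    ∈I⇒chosen {z} z∈ = invert (chosen? z) (trans (sym (Vec.lookup∘tabulate (does ∘ chosen?) z)) z∈)
      where
      invert : (d : Dec (Chosen z)) → does d ≡ true → Chosen z
      invert (yes ch) _ = ch

    chosen⇒∈I : ∀ {z} → Chosen z → vlookup I z ≡ true
    chosen⇒∈I {z} ch = trans (Vec.lookup∘tabulate (does ∘ chosen?) z) (dec-true (chosen? z) ch)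

    Goal : Set
    Goal = ∃ λ I → InItilde n m I × + length S ≤ℤ objective n m g I +ℤ (+ (m + 1))

    bound : ∀ zs → elems I ≡ zs → Goal
    bound [] eq = contradiction
      (subst (proj₁ anchored ∈ₗ_) eq (∈elems⁺ I (chosen⇒∈I (inj₁ (proj₂ anchored))))) λ ()
    bound (x ∷ ys) eq = I ,
      ( (x , Vec.lookup⇒[]= x I (∈elems⁻ I (subst (x ∈ₗ_) (sym eq) (here refl))))
      , labels-apart⇒independent I (λ y∈ z∈ → chosen-far (∈I⇒chosen y∈) (∈I⇒chosen z∈))
      , subst₂ _≤_ (sym (trans (cong (minL ∘ map lab) eq) (minL-increasing inc))) (+-comm 1 m)
          (head≤1+m inc all-chosen complete)
      , subst (λ zs → n ∸ m ≤ maxL (map lab zs)) (sym eq)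
          (m≤n+o⇒m∸n≤o n m (subst (n ≤_) (+-comm _ m) (n≤max+m inc all-chosen complete)))
      ) ,
      +-cancel-≤ℤ (+ (length ys * suc m + lab x)) (subst (+ length S +ℤ (+ (length ys * suc m + lab x)) ≤ℤ_)
        (sym (objective-clear m g I eq))
        (+≤+ (subst (_≤ sum (map g (x ∷ ys)) + maxL (map lab (x ∷ ys))) (+-assoc T _ _)
          (length-bound inc all-chosen complete))))
      where
      inc : Increasing (x ∷ ys)
      inc = subst Increasing eq (elems-increasing I)
      all-chosen : All Chosen (x ∷ ys)
      all-chosen = All.tabulate (λ z∈ → ∈I⇒chosen (∈elems⁻ I (subst (_ ∈ₗ_) (sym eq) z∈)))
      complete : ∀ z → Chosen z → z ∈ₗ x ∷ ys
      complete z ch = subst (z ∈ₗ_) eq (∈elems⁺ I (chosen⇒∈I ch))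

-- Walking along the sequence S_P(I)

from-labels : ∀ {n} {ks : List ℕ} → All (λ k → 1 ≤ k × k ≤ n) ks → ∃ λ (is : List (Fin n)) → map lab is ≡ ks
from-labels [] = [] , refl
from-labels ((1≤k , k≤n) ∷ inside) with lab-surjective 1≤k k≤n | from-labels inside
... | i , eq | is , eqs = i ∷ is , cong₂ _∷_ eq eqs

lab≤maxL : ∀ {n} {x y : Fin n} {ys} → lab x < lab y → lab x ≤ maxL (map lab (y ∷ ys))
lab≤maxL {y = y} {ys} x<y = ≤-trans (<⇒≤ x<y) (m≤m⊔n (lab y) (maxL (map lab ys)))

module Construction (n m : ℕ) (1≤m : 1 ≤ m) (R : Fin n → FinGraph) (I : Subset n)
  (Ss : (i : Fin n) → List (Fin (size (R i)))) (c : (i : Fin n) → Fin (size (R i))) where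
  open JoinGraph n m R

  copy : (i : Fin n) → Fin (size (R i)) → V G⋈R
  copy i x = i , x

  -- This is `expand` read on path vertices instead of labels, which removes the out-of-range cases.
  block : Fin n → List (V G⋈R)
  block i = if vlookup I i then map (copy i) (Ss i) else [ (i , c i) ]

  expand-suc : ∀ {k} (k<n : k < n) → expand n R I Ss c (suc k) ≡ block (fromℕ< k<n)
  expand-suc {k} k<n with k <? n
  ... | no  k≮n = contradiction k<n k≮n
  ... | yes k<n′ with vlookup I (fromℕ< k<n′)
  ...   | true  = refl
  ...   | false = refl

  expand-lab : ∀ i → expand n R I Ss c (lab i) ≡ block i
  expand-lab i = trans (expand-suc (Fin.toℕ<n i)) (cong block (Fin.fromℕ<-toℕ i (Fin.toℕ<n i)))

  block-outside : ∀ {i} → vlookup I i ≡ false → block i ≡ [ (i , c i) ]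
  block-outside {i} eq = cong (λ b → if b then map (copy i) (Ss i) else [ (i , c i) ]) eq

  block-inside : ∀ {i} → vlookup I i ≡ true → block i ≡ map (copy i) (Ss i)
  block-inside {i} eq = cong (λ b → if b then map (copy i) (Ss i) else [ (i , c i) ]) eq

  length-outside : ∀ {is} → All (λ i → vlookup I i ≡ false) is → length (concatMap block is) ≡ length is
  length-outside [] = refl
  length-outside {i ∷ is} (i∉ ∷ is∉) =
    trans (cong (λ b → length (b ++ concatMap block is)) (block-outside i∉)) (cong suc (length-outside is∉))

  -- What keeps copy `i` away from the footprints of a later `j`: for `j` in I they lie in copy `j`,
  -- which must be more than m away; otherwise the footprint lies in copy `j + m`, and `i < j` is
  -- enough.
  Ordered : Fin n → Fin n → Set
  Ordered i j = lab i < lab j × (vlookup I j ≡ true → lab i + m < lab j)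

  -- Outside I the footprint of the vertex chosen in G_i is taken in G_{i+m}.
  Placed : Fin n → Set
  Placed i = vlookup I i ≡ true ⊎ (vlookup I i ≡ false × lab i + m ≤ n)

  module _ (g : Fin n → ℕ) (length-Ss : ∀ i → length (Ss i) ≡ g i) where

    length-inside : ∀ {i} → vlookup I i ≡ true → length (block i) ≡ g i
    length-inside {i} i∈ = trans (cong length (block-inside i∈)) (trans (length-map (copy i) (Ss i)) (length-Ss i))

    -- `covers` demands `i ≢ j` because the single vertex chosen in a copy outside I need not
    -- dominate that copy, while any vertex of a neighbouring copy does. `total` matches
    -- `objective-clear`.
    record Walk (x : Fin n) (ys : List (Fin n)) : Set where
      field
        is      : List (Fin n)
        labels≡ : map lab is ≡ SPList m (map lab (x ∷ ys))
        ordered : AllPairs Ordered is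
        from    : All (λ i → lab x ≤ lab i × Placed i) is
        hits    : ∀ j → lab x ≤ lab j → vlookup I j ≡ true → j ∈ₗ is
        covers  : ∀ j → lab x ≤ lab j → vlookup I j ≡ false → ∃ λ i → i ∈ₗ is × i ≢ j × Near m i j
        total   : length (concatMap block is) + length ys * suc m + lab x ≡
                  sum (map g (x ∷ ys)) + maxL (map lab (x ∷ ys))

    ≢-of-mem : ∀ {i j : Fin n} → vlookup I i ≡ true → vlookup I j ≡ false → i ≢ j
    ≢-of-mem i∈ j∉ refl = contradiction (trans (sym i∈) j∉) λ ()

    walk : ∀ x ys → Increasing (x ∷ ys) → All (λ i → vlookup I i ≡ true) (x ∷ ys) →
      (∀ z → vlookup I z ≡ true → lab x < lab z → z ∈ₗ ys) →
      (∀ {y z} → vlookup I y ≡ true → vlookup I z ≡ true → lab y < lab z → lab y + m < lab z) →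
      n ≤ maxL (map lab (x ∷ ys)) + m → Walk x ys
    walk x [] _ (x∈ ∷ _) complete apart end = record
      { is      = x ∷ []
      ; labels≡ = refl
      ; ordered = [] ∷ []
      ; from    = (≤-refl , inj₁ x∈) ∷ []
      ; hits    = hits′
      ; covers  = λ j x≤j j∉ → x , here refl , ≢-of-mem x∈ j∉ ,
                    (≤-trans x≤j (m≤m+n _ m) ,
                     ≤-trans (Fin.toℕ<n j) (subst (λ k → n ≤ k + m) (⊔-identityʳ (lab x)) end))
      ; total   = trans (cong (_+ lab x) (+-identityʳ (length (block x ++ []))))
                    (cong₂ _+_ (trans (length-++ (block x)) (cong (_+ 0) (length-inside x∈)))
                      (sym (⊔-identityʳ (lab x))))
      }
      where
      hits′ : ∀ j → lab x ≤ lab j → vlookup I j ≡ true → j ∈ₗ x ∷ []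
      hits′ j x≤j j∈ with m≤n⇒m<n∨m≡n x≤j
      ... | inj₁ x<j = contradiction (complete j j∈ x<j) λ ()
      ... | inj₂ eq  = here (sym (lab-injective eq))
    walk x (y ∷ ys) (x< ∷ inc) (x∈ ∷ y∈ ∷ ys∈) complete apart end = extend
      (walk y ys inc (y∈ ∷ ys∈) (λ z z∈ y<z → above-head (complete z z∈ (<-trans x<y y<z)) y<z) apart
        (subst (λ k → n ≤ k + m) max≡ end))
      where
      x<y : lab x < lab y
      x<y = All.head x<

      max≡ : maxL (map lab (x ∷ y ∷ ys)) ≡ maxL (map lab (y ∷ ys))
      max≡ = m≤n⇒m⊔n≡n (lab≤maxL {ys = ys} x<y)

      -- The segment from `x` to `y - (m + 1)` has `e` vertices besides `x`.
      e : ℕ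
      e = lab y ∸ (lab x + suc m)

      y≡ : e + (lab x + suc m) ≡ lab y
      y≡ = m∸n+n≡m (subst (_≤ lab y) (sym (+-suc (lab x) m)) (apart x∈ y∈ x<y))

      range≡ : S-range (lab x) (lab y ∸ (m + 1)) ≡ map (λ k → lab x + k) (upTo (suc e))
      range≡ = cong (λ k → map (λ k → lab x + k) (upTo k)) (trans
        (cong (_∸ lab x) (trans (cong (λ k → suc (k ∸ (m + 1))) (trans (sym y≡) (arrange e (lab x) m)))
          (cong suc (m+n∸n≡m (e + lab x) (m + 1)))))
        (m+n∸n≡m (suc e) (lab x)))
        where
        arrange : ∀ e x m → e + (x + suc m) ≡ e + x + (m + 1)
        arrange = solve-∀

      step<y : ∀ {t} → t < suc e → lab x + t + m < lab y
      step<y {t} t≤e = subst (lab x + t + m <_) y≡ (subst (lab x + t + m <_) (arrange e (lab x) m)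
        (s≤s (+-monoˡ-≤ m (+-monoʳ-≤ (lab x) (s≤s⁻¹ t≤e)))))
        where
        arrange : ∀ e x m → suc (x + e + m) ≡ e + (x + suc m)
        arrange = solve-∀

      segment : ∃ λ (rs : List (Fin n)) → map lab rs ≡ map (λ k → lab x + k) (applyUpTo suc e)
      segment = from-labels (All.map⁺ (All.applyUpTo⁺₁ suc e λ {t} t<e →
        s≤s z≤n , ≤-trans (≤-trans (m≤m+n _ m) (<⇒≤ (step<y (s≤s t<e)))) (Fin.toℕ<n y)))

      rs : List (Fin n)
      rs = proj₁ segment

      x∷rs≡ : map lab (x ∷ rs) ≡ map (λ k → lab x + k) (upTo (suc e))
      x∷rs≡ = cong₂ _∷_ (sym (+-identityʳ (lab x))) (proj₂ segment)

      rs-bounds : All (λ i → lab x < lab i × lab i + m < lab y) rs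
      rs-bounds = All.map⁻ (subst (All (λ k → lab x < k × k + m < lab y)) (sym (proj₂ segment))
        (All.map⁺ (All.applyUpTo⁺₁ suc e λ {t} t<e →
          subst (lab x <_) (sym (+-suc (lab x) t)) (s≤s (m≤m+n (lab x) t)) , step<y (s≤s t<e))))

      x∷rs-increasing : Increasing (x ∷ rs)
      x∷rs-increasing = AllPairs.map⁻ (subst (AllPairs _<_) (sym x∷rs≡)
        (AllPairs.map⁺ (AllPairs.applyUpTo⁺₁ id (suc e) λ i<j _ → +-monoʳ-< (lab x) i<j)))

      gap : ∀ {j} → lab x < lab j → lab j < lab y → vlookup I j ≡ false
      gap {j} lo hi = Bool.¬-not λ j∈ → <⇒≱ hi (head-least inc (complete j j∈ lo))

      <y : ∀ {i : Fin n} → lab i + m < lab y → lab i < lab y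
      <y = ≤-<-trans (m≤m+n _ m)

      rs-outside : All (λ i → vlookup I i ≡ false) rs
      rs-outside = All.map (λ (lo , hi) → gap lo (<y hi)) rs-bounds

      below-y : All (λ i → lab x ≤ lab i × lab i + m < lab y) (x ∷ rs)
      below-y = (≤-refl , apart x∈ y∈ x<y) ∷ All.map (λ (lo , hi) → <⇒≤ lo , hi) rs-bounds

      extend : Walk y ys → Walk x (y ∷ ys)
      extend wk = record
        { is      = (x ∷ rs) ++ is
        ; labels≡ = trans (map-++ lab (x ∷ rs) is) (cong₂ _++_ (trans x∷rs≡ (sym range≡)) labels≡)
        ; ordered = AllPairs.++⁺
            (AllPairs-refine (λ { (x≤i , _) (_ , j<y) i<j → i<j , λ j∈ →
                contradiction (trans (sym j∈) (gap (≤-<-trans x≤i i<j) (<y j<y))) λ () })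
              below-y x∷rs-increasing)
            ordered
            (All.map (λ (_ , i<y) → All.map (λ (y≤j , _) →
                <-≤-trans (<y i<y) y≤j , λ _ → <-≤-trans i<y y≤j) from) below-y)
        ; from    = All.++⁺
            ((≤-refl , inj₁ x∈) ∷ All.zipWith (λ ((lo , hi) , i∉) →
                <⇒≤ lo , inj₂ (i∉ , ≤-trans (<⇒≤ hi) (Fin.toℕ<n y))) (rs-bounds , rs-outside))
            (All.map (λ (y≤i , placed) → ≤-trans (<⇒≤ x<y) y≤i , placed) from)
        ; hits    = hits′
        ; covers  = covers′
        ; total   = total′
        }
        where
        open Walk wk

        hits′ : ∀ j → lab x ≤ lab j → vlookup I j ≡ true → j ∈ₗ (x ∷ rs) ++ is
        hits′ j x≤j j∈ with m≤n⇒m<n∨m≡n x≤j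
        ... | inj₁ x<j = ∈-++⁺ʳ (x ∷ rs) (hits j (head-least inc (complete j j∈ x<j)) j∈)
        ... | inj₂ eq  = here (sym (lab-injective eq))

        -- Up to `x + m` the vertex `x` serves. A later `j` before `y` is covered by `j - m`, which
        -- is in the segment as that ends at `y - (m + 1)`, and which differs from `j` since
        -- `1 ≤ m`.
        covers′ : ∀ j → lab x ≤ lab j → vlookup I j ≡ false → ∃ λ i → i ∈ₗ (x ∷ rs) ++ is × i ≢ j × Near m i j
        covers′ j x≤j j∉ with lab y ≤? lab j | lab j ≤? lab x + m
        ... | yes y≤j | _ = let i , i∈ , i≢j , near = covers j y≤j j∉ in i , ∈-++⁺ʳ (x ∷ rs) i∈ , i≢j , near
        ... | no _ | yes close = x , here refl , ≢-of-mem x∈ j∉ , (≤-trans x≤j (m≤m+n _ m) , close)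
        ... | no y≰j | no x+m≱j with ∈-map⁻ lab (subst (lab j ∸ m ∈ₗ_) (sym x∷rs≡)
                (subst (_∈ₗ map (λ k → lab x + k) (upTo (suc e))) t≡ (∈-map⁺ (λ k → lab x + k) (∈-upTo⁺ t≤e))))
          where
          x+m<j : lab x + m < lab j
          x+m<j = ≰⇒> x+m≱j
          t : ℕ
          t = lab j ∸ (lab x + m)
          t+x+m≡j : t + (lab x + m) ≡ lab j
          t+x+m≡j = m∸n+n≡m (<⇒≤ x+m<j)
          t≡ : lab x + t ≡ lab j ∸ m
          t≡ = trans (sym (m+n∸n≡m (lab x + t) m)) (cong (_∸ m) (trans (arrange (lab x) t m) t+x+m≡j))
            where
            arrange : ∀ x t m → x + t + m ≡ t + (x + m)
            arrange = solve-∀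
          t≤e : t < suc e
          t≤e = +-cancelʳ-≤ (lab x + m) (suc t) (suc e) (subst₂ _≤_ (sym (cong suc t+x+m≡j))
            (trans (sym y≡) (arrange e (lab x) m)) (≰⇒> y≰j))
            where
            arrange : ∀ e x m → e + (x + suc m) ≡ suc e + (x + m)
            arrange = solve-∀
        ...   | i , i∈ , j∸m≡i = i , ∈-++⁺ˡ i∈ , (λ { refl → <⇒≢ i<j refl }) ,
                  (≤-trans (<⇒≤ i<j) (m≤m+n _ m) , ≤-reflexive (sym i+m≡j))
          where
          i+m≡j : lab i + m ≡ lab j
          i+m≡j = trans (cong (_+ m) (sym j∸m≡i))
            (m∸n+n≡m (≤-trans (m≤n+m m (lab x)) (<⇒≤ (≰⇒> x+m≱j))))
          i<j : lab i < lab j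
          i<j = subst (lab i <_) i+m≡j (m<m+n (lab i) 1≤m)

        total′ : length (concatMap block ((x ∷ rs) ++ is)) + length (y ∷ ys) * suc m + lab x ≡
                 sum (map g (x ∷ y ∷ ys)) + maxL (map lab (x ∷ y ∷ ys))
        total′ = begin
          length (concatMap block ((x ∷ rs) ++ is)) + length (y ∷ ys) * suc m + lab x
            ≡⟨ cong (λ k → k + length (y ∷ ys) * suc m + lab x) length≡ ⟩
          g x + e + length (concatMap block is) + (suc m + length ys * suc m) + lab x
            ≡⟨ arrange (g x) e (length (concatMap block is)) (suc m) (length ys * suc m) (lab x) ⟩
          g x + (length (concatMap block is) + length ys * suc m + (e + (lab x + suc m)))
            ≡⟨ cong (λ k → g x + (length (concatMap block is) + length ys * suc m + k)) y≡ ⟩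
          g x + (length (concatMap block is) + length ys * suc m + lab y)
            ≡⟨ cong (λ k → g x + k) total ⟩
          g x + (sum (map g (y ∷ ys)) + maxL (map lab (y ∷ ys)))
            ≡⟨ +-assoc (g x) _ _ ⟨
          g x + sum (map g (y ∷ ys)) + maxL (map lab (y ∷ ys))
            ≡⟨ cong (λ k → g x + sum (map g (y ∷ ys)) + k) max≡ ⟨
          sum (map g (x ∷ y ∷ ys)) + maxL (map lab (x ∷ y ∷ ys)) ∎
          where
          open ≡-Reasoning
          arrange : ∀ a e l s k x → a + e + l + (s + k) + x ≡ a + (l + k + (e + (x + s)))
          arrange = solve-∀
          length-rs : length rs ≡ e
          length-rs = trans (sym (length-map lab rs)) (trans (cong length (proj₂ segment))
            (trans (length-map (λ k → lab x + k) (applyUpTo suc e)) (length-applyUpTo suc e)))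
          length≡ : length (concatMap block ((x ∷ rs) ++ is)) ≡ g x + e + length (concatMap block is)
          length≡ = begin
            length (concatMap block ((x ∷ rs) ++ is))
              ≡⟨ cong length (concatMap-++ block (x ∷ rs) is) ⟩
            length ((block x ++ concatMap block rs) ++ concatMap block is)
              ≡⟨ length-++ (block x ++ concatMap block rs) ⟩
            length (block x ++ concatMap block rs) + length (concatMap block is)
              ≡⟨ cong (_+ length (concatMap block is)) (trans (length-++ (block x))
                   (cong₂ _+_ (length-inside x∈) (trans (length-outside rs-outside) length-rs))) ⟩
            g x + e + length (concatMap block is) ∎

-- Lower bound

independent⇒labels-apart : ∀ {n m} (I : Subset n) → Independent (PathPow n m) (λ z → z ∈ I) →
  ∀ {y z} → vlookup I y ≡ true → vlookup I z ≡ true → lab y < lab z → lab y + m < lab z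
independent⇒labels-apart {n} {m} I ind {y} {z} y∈ z∈ y<z with lab y + m <? lab z
... | yes lt = lt
... | no  ≮ with trans (sym (near⇒adj {n} {m} {y} {z} (λ { refl → <-irrefl refl y<z })
              (≤-trans (<⇒≤ y<z) (m≤m+n _ m) , ≮⇒≥ ≮)))
              (ind y z (Vec.lookup⇒[]= y I y∈) (Vec.lookup⇒[]= z I z∈))
...   | ()

+-cancel-≡ℤ : ∀ {i j : ℤ} (k : ℤ) → i +ℤ k ≡ j +ℤ k → i ≡ j
+-cancel-≡ℤ k eq = ℤ.≤-antisym (+-cancel-≤ℤ k (ℤ.≤-reflexive eq)) (+-cancel-≤ℤ k (ℤ.≤-reflexive (sym eq)))

module LowerBound (n m : ℕ) (1≤m : 1 ≤ m) (R : Fin n → FinGraph) (I : Subset n)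
  (Ss : (i : Fin n) → List (Fin (size (R i)))) (legal : ∀ i → LegalDom (toGraph (R i)) (Ss i))
  (c : (i : Fin n) → Fin (size (R i))) where
  open JoinGraph n m R
  open Construction n m 1≤m R I Ss c

  Target : Fin n → V G⋈R → Set
  Target i u = (vlookup I i ≡ true × lab (proj₁ u) ≡ lab i) ⊎ (vlookup I i ≡ false × lab (proj₁ u) ≡ lab i + m)

  witnessed-block : ∀ i → Placed i → ∃ λ L → map proj₁ L ≡ block i × Witnessed G⋈R L ×
    All (λ e → proj₁ (proj₁ e) ≡ i × Target i (proj₂ e)) L
  witnessed-block i (inj₁ i∈) with legal⇒witnessed (toGraph (R i)) (proj₂ (proj₂ (legal i)))
  ... | L , L≡ , near , far =
    map both L ,
    trans (trans (sym (map-∘ L)) (trans (map-∘ L) (cong (map (copy i)) L≡))) (sym (block-inside i∈)) ,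
    ( All.map⁺ (All.map fibre⇒join near)
    , AllPairs.map⁺ (AllPairs.map (λ ¬near near′ → ¬near (join⇒fibre near′)) far) ) ,
    All.map⁺ (All.universal (λ _ → refl , inj₁ (i∈ , refl)) L)
    where
    both : Fin (size (R i)) × Fin (size (R i)) → V G⋈R × V G⋈R
    both (x , y) = copy i x , copy i y
  witnessed-block i (inj₂ (i∉ , i+m≤n)) with lab-surjective (≤-trans (s≤s z≤n) (m≤m+n (lab i) m)) i+m≤n
  ... | j , j≡i+m =
    -- Any vertex of copy `j` could be the footprint, because copies at distance m are completely
    -- joined.
    [ (i , c i) , (j , c j) ] , sym (block-outside i∉) ,
    ( join-cross (λ { refl → <⇒≢ (m<m+n (lab i) 1≤m) j≡i+m })
        (≤-trans (m≤m+n (lab i) m) (≤-trans (≤-reflexive (sym j≡i+m)) (m≤m+n (lab j) m)) , ≤-reflexive j≡i+m) ∷ []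
    , [] ∷ [] ) ,
    (refl , inj₂ (i∉ , j≡i+m)) ∷ []

  ordered-sep : ∀ {i j a b} → Ordered i j → proj₁ a ≡ i → Target j b → ¬ InN G⋈R a b
  ordered-sep {i} (_ , far) refl (inj₁ (j∈ , b≡j)) inN =
    <⇒≱ (far j∈) (subst (_≤ lab i + m) b≡j (proj₂ (join-near inN)))
  ordered-sep {i} (i<j , _) refl (inj₂ (_ , b≡j+m)) inN =
    <⇒≱ (+-monoˡ-< m i<j) (subst (_≤ lab i + m) b≡j+m (proj₂ (join-near inN)))

  witnessed-blocks : ∀ {is} → AllPairs Ordered is → All Placed is →
    ∃ λ L → map proj₁ L ≡ concatMap block is × Witnessed G⋈R L ×
      All (λ e → ∃ λ j → j ∈ₗ is × Target j (proj₂ e)) L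
  witnessed-blocks [] [] = [] , refl , ([] , []) , []
  witnessed-blocks {i ∷ is} (i< ∷ ordered) (placed ∷ all-placed)
    with witnessed-block i placed | witnessed-blocks ordered all-placed
  ... | L , L≡ , (near , far) , targets | L′ , L′≡ , (near′ , far′) , targets′ =
    L ++ L′ , trans (map-++ proj₁ L L′) (cong₂ _++_ L≡ L′≡) ,
    ( All.++⁺ near near′
    , AllPairs.++⁺ far far′ (All.map (λ (v≡i , _) → All.map (λ (j , j∈ , target) →
        ordered-sep (All.lookup i< j∈) v≡i target) targets′) targets) ) ,
    All.++⁺ (All.map (λ (_ , target) → i , here refl , target) targets)
      (All.map (λ (j , j∈ , target) → j , there j∈ , target) targets′)

  ∈-blocks : ∀ {i v is} → i ∈ₗ is → v ∈ₗ block i → v ∈ₗ concatMap block is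
  ∈-blocks i∈ v∈ = ∈-concatMap⁺ block (lose i∈ v∈)

  block-dominates : ∀ {j} → vlookup I j ≡ true → ∀ y → ∃ λ v → v ∈ₗ block j × InN G⋈R v (j , y)
  block-dominates {j} j∈ y =
    let z , z∈ , near = proj₁ (proj₂ (legal j)) y
    in (j , z) , subst ((j , z) ∈ₗ_) (sym (block-inside j∈)) (∈-map⁺ (copy j) z∈) , fibre⇒join near

  block-inhabited : ∀ i → ∃ λ x → (i , x) ∈ₗ block i
  block-inhabited i = go (vlookup I i) refl
    where
    go : ∀ b → vlookup I i ≡ b → ∃ λ x → (i , x) ∈ₗ block i
    go true  i∈ = let z , z∈ , _ = proj₁ (proj₂ (legal i)) (c i)
                  in z , subst ((i , z) ∈ₗ_) (sym (block-inside i∈)) (∈-map⁺ (copy i) z∈)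
    go false i∉ = c i , subst ((i , c i) ∈ₗ_) (sym (block-outside i∉)) (here refl)

  module _ (g : Fin n → ℕ) (length-Ss : ∀ i → length (Ss i) ≡ g i) (I∈ : InItilde n m I) where

    apart : ∀ {y z} → vlookup I y ≡ true → vlookup I z ≡ true → lab y < lab z → lab y + m < lab z
    apart = independent⇒labels-apart I (proj₁ (proj₂ I∈))

    Attained : Set
    Attained = LegalDom G⋈R (replaceSeq n m R I Ss c) ×
      + length (replaceSeq n m R I Ss c) ≡ objective n m g I +ℤ (+ (m + 1))

    attained-from : ∀ x ys → elems I ≡ x ∷ ys → Attained
    attained-from x ys eq = subst (LegalDom G⋈R) (trans (proj₁ (proj₂ blocks)) (sym replace≡)) legal-blocks ,
      length≡
      where
      inc : Increasing (x ∷ ys)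
      inc = subst Increasing eq (elems-increasing I)

      complete : ∀ z → vlookup I z ≡ true → z ∈ₗ x ∷ ys
      complete z z∈ = subst (z ∈ₗ_) eq (∈elems⁺ I z∈)

      all-in : All (λ i → vlookup I i ≡ true) (x ∷ ys)
      all-in = All.tabulate (λ z∈ → ∈elems⁻ I (subst (_ ∈ₗ_) (sym eq) z∈))

      x≤1+m : lab x ≤ m + 1
      x≤1+m = subst (_≤ m + 1) (trans (cong (minL ∘ map lab) eq) (minL-increasing inc)) (proj₁ (proj₂ (proj₂ I∈)))

      n≤max+m : n ≤ maxL (map lab (x ∷ ys)) + m
      n≤max+m = ≤-trans (m≤n+m∸n n m) (≤-trans (≤-reflexive (+-comm m (n ∸ m)))
        (+-monoˡ-≤ m (subst (λ zs → n ∸ m ≤ maxL (map lab zs)) eq (proj₂ (proj₂ (proj₂ I∈))))))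

      open Walk (walk g length-Ss x ys inc all-in (λ z z∈ x<z → above-head (complete z z∈) x<z) apart n≤max+m)

      replace≡ : replaceSeq n m R I Ss c ≡ concatMap block is
      replace≡ = begin
        concatMap (expand n R I Ss c) (SPList m (map lab (elems I)))
          ≡⟨ cong (λ zs → concatMap (expand n R I Ss c) (SPList m (map lab zs))) eq ⟩
        concatMap (expand n R I Ss c) (SPList m (map lab (x ∷ ys)))
          ≡⟨ cong (concatMap (expand n R I Ss c)) labels≡ ⟨
        concatMap (expand n R I Ss c) (map lab is)
          ≡⟨ concatMap-map (expand n R I Ss c) lab is ⟩
        concatMap (expand n R I Ss c ∘ lab) is
          ≡⟨ concatMap-cong expand-lab is ⟩
        concatMap block is ∎
        where open ≡-Reasoning

      blocks : ∃ λ L → map proj₁ L ≡ concatMap block is × Witnessed G⋈R L ×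
        All (λ e → ∃ λ j → j ∈ₗ is × Target j (proj₂ e)) L
      blocks = witnessed-blocks ordered (All.map proj₂ from)

      dominates : ∀ j y → (b : _) → vlookup I j ≡ b → ∃ λ v → v ∈ₗ concatMap block is × InN G⋈R v (j , y)
      dominates j y true j∈ =
        let v , v∈ , near = block-dominates j∈ y
        in v , ∈-blocks (hits j (head-least inc (complete j j∈)) j∈) v∈ , near
      dominates j y false j∉ =
        let i , i∈ , i≢j , near = cover
            z , z∈ = block-inhabited i
        in (i , z) , ∈-blocks i∈ z∈ , join-cross i≢j near
        where
        cover : ∃ λ i → i ∈ₗ is × i ≢ j × Near m i j
        cover with lab x ≤? lab j
        ... | yes x≤j = covers j x≤j j∉
        -- To the left of the first member of I, the condition `lab x ≤ m + 1` brings every `j`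
        -- within m of `x`.
        ... | no  x≰j = x , hits x ≤-refl (All.head all-in) , (λ { refl → x≰j ≤-refl }) ,
              (≤-trans x≤1+m (≤-trans (≤-reflexive (+-comm m 1)) (+-monoˡ-≤ m (s≤s z≤n))) ,
               ≤-trans (<⇒≤ (≰⇒> x≰j)) (m≤m+n _ m))

      legal-blocks : LegalDom G⋈R (map proj₁ (proj₁ blocks))
      legal-blocks = witnessed⇒legalDom G⋈R (proj₁ (proj₂ (proj₂ blocks)))
        (λ (j , y) → subst (λ S → ∃ λ v → v ∈ₗ S × InN G⋈R v (j , y)) (sym (proj₁ (proj₂ blocks)))
          (dominates j y (vlookup I j) refl))

      length≡ : + length (replaceSeq n m R I Ss c) ≡ objective n m g I +ℤ (+ (m + 1))
      length≡ = +-cancel-≡ℤ (+ B) (begin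
        + (length (replaceSeq n m R I Ss c) + B)        ≡⟨ cong (λ S → + (length S + B)) replace≡ ⟩
        + (length (concatMap block is) + B)             ≡⟨ cong +_ (+-assoc (length (concatMap block is)) _ _) ⟨
        + (length (concatMap block is) + length ys * suc m + lab x) ≡⟨ cong +_ total ⟩
        + (sum (map g (x ∷ ys)) + maxL (map lab (x ∷ ys)))          ≡⟨ objective-clear m g I eq ⟨
        objective n m g I +ℤ (+ (m + 1)) +ℤ (+ B)       ∎)
        where
        open ≡-Reasoning
        B : ℕ
        B = length ys * suc m + lab x

    attained : Attained
    attained = go (elems I) refl
      where
      go : ∀ zs → elems I ≡ zs → Attained
      go []       eq = contradiction
        (subst (proj₁ (proj₁ I∈) ∈ₗ_) eq (∈elems⁺ I (Vec.[]=⇒lookup (proj₂ (proj₁ I∈))))) λ ()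
      go (x ∷ ys) eq = attained-from x ys eq

-- Combining the two bounds

grundy-length : (G : Graph) {k : ℕ} {S : List (V G)} → IsGrundyNumber G k → IsGrundyDomSeq G S → length S ≡ k
grundy-length G ((S₀ , legal₀ , refl) , maximal) (legal , maximal′) =
  ≤-antisym (maximal _ legal) (maximal′ S₀ legal₀)

theorem5 : (n m : ℕ) → 1 ≤ m → m + 2 ≤ n →
    (R : Fin n → FinGraph) → (g : Fin n → ℕ) →
    (∀ i → IsGrundyNumber (toGraph (R i)) (g i)) →
    ((k : ℕ) → IsGrundyNumber (Join n m R) k ⇔
    ((∃ λ I → InItilde n m I × objective n m g I +ℤ (+ (m + 1)) ≡ + k) ×
    (∀ I → InItilde n m I → objective n m g I +ℤ (+ (m + 1)) ≤ℤ + k)))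
    ×
    ((Ss : (i : Fin n) → List (Fin (size (R i)))) →
    (∀ i → IsGrundyDomSeq (toGraph (R i)) (Ss i)) →
    (c : (i : Fin n) → Fin (size (R i))) →
    (I : Subset n) → InItilde n m I →
    (k : ℕ) → IsGrundyNumber (Join n m R) k →
    objective n m g I +ℤ (+ (m + 1)) ≡ + k →
    IsGrundyDomSeq (Join n m R) (replaceSeq n m R I Ss c))
theorem5 n m 1≤m m+2≤n R g grundy = (λ k → mk⇔ (to k) (from k)) , grundy-sequence
  where
  open UpperBound n m m+2≤n R g grundy using (length≤objective; some-vertex)

  Ss₀ : ∀ i → List (Fin (size (R i)))
  Ss₀ i = proj₁ (proj₁ (grundy i))

  lower : ∀ I → InItilde n m I → LegalDom (Join n m R) (replaceSeq n m R I Ss₀ some-vertex) ×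
    + length (replaceSeq n m R I Ss₀ some-vertex) ≡ objective n m g I +ℤ (+ (m + 1))
  lower I = LowerBound.attained n m 1≤m R I Ss₀ (λ i → proj₁ (proj₂ (proj₁ (grundy i)))) some-vertex
    g (λ i → proj₂ (proj₂ (proj₁ (grundy i))))

  to : ∀ k → IsGrundyNumber (Join n m R) k →
    (∃ λ I → InItilde n m I × objective n m g I +ℤ (+ (m + 1)) ≡ + k) ×
    (∀ I → InItilde n m I → objective n m g I +ℤ (+ (m + 1)) ≤ℤ + k)
  to k ((S , legal , refl) , maximal) with length≤objective S legal
  -- The set obtained from a longest sequence also carries a legal sequence as long as its objective
  -- value, so it attains `k`.
  ... | I , I∈ , S≤ = (I , I∈ , ℤ.≤-antisym (objective≤ I I∈) S≤) , objective≤
    where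
    objective≤ : ∀ I → InItilde n m I → objective n m g I +ℤ (+ (m + 1)) ≤ℤ + k
    objective≤ I I∈ = let legal′ , len = lower I I∈ in subst (_≤ℤ + k) len (+≤+ (maximal _ legal′))

  from : ∀ k → (∃ λ I → InItilde n m I × objective n m g I +ℤ (+ (m + 1)) ≡ + k) ×
    (∀ I → InItilde n m I → objective n m g I +ℤ (+ (m + 1)) ≤ℤ + k) → IsGrundyNumber (Join n m R) k
  from k ((I , I∈ , obj≡k) , obj≤k) =
    (let legal , len = lower I I∈ in _ , legal , ℤ.+-injective (trans len obj≡k)) ,
    λ S legal → let I′ , I′∈ , S≤ = length≤objective S legal in ℤ.drop‿+≤+ (ℤ.≤-trans S≤ (obj≤k I′ I′∈))

  grundy-sequence : (Ss : (i : Fin n) → List (Fin (size (R i)))) →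
    (∀ i → IsGrundyDomSeq (toGraph (R i)) (Ss i)) → (c : (i : Fin n) → Fin (size (R i))) →
    (I : Subset n) → InItilde n m I → (k : ℕ) → IsGrundyNumber (Join n m R) k →
    objective n m g I +ℤ (+ (m + 1)) ≡ + k → IsGrundyDomSeq (Join n m R) (replaceSeq n m R I Ss c)
  grundy-sequence Ss grundy-Ss c I I∈ k (_ , maximal) obj≡k =
    let legal , len = LowerBound.attained n m 1≤m R I Ss (proj₁ ∘ grundy-Ss) c g
                        (λ i → grundy-length (toGraph (R i)) (grundy i) (grundy-Ss i)) I∈
    in legal , λ S′ legal′ → ≤-trans (maximal S′ legal′) (≤-reflexive (sym (ℤ.+-injective (trans len obj≡k))))
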